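{- Assume Dickson's prime $k$-tuples conjecture: for every $k\ge1$ and all integers $a_1,\dots,a_k\ge1$ and $b_1,\dots,b_k$ such that there is no prime $\ell$ dividing $\prod_{i=1}^k(a_it+b_i)$ for every integer $t$, there are infinitely many positive integers $t$ for which $a_1t+b_1,\dots,a_kt+b_k$ are all prime. Then for every fixed $\varepsilon>0$ there are infinitely many triples $(m,n,x)$ with $m\ne n$ positive integers and $x$ a nonzero real number such that $\Phi_m(x)=\Phi_n(x)$ and the inequality $\frac12<|x|<2-\varepsilon$ fails.
   Context: For a positive integer $n$, $\Phi_n$ denotes the $n$-th cyclotomic polynomial, $\Phi_n(x)=\prod_{1\le a\le n,\ \gcd(a,n)=1}(x-\zeta_n^a)$, where $\zeta_n$ is a primitive $n$-th root of unity. -}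

module Defs where

open import Level using (0ℓ; _⊔_)
open import Algebra.Bundles.Raw using (RawRing)
import Algebra.Definitions.RawSemiring as RawSemiringDefinitions
open import Data.Integer.Base as ℤ using (ℤ; 0ℤ; 1ℤ)
open import Data.Integer.Divisibility using () renaming (_∣_ to _∣ℤ_)
open import Data.List.Base using (List; map; filter; foldr; upTo)
import Data.List.Membership.Setoid as Membership
open import Data.Nat.Base as ℕ using (ℕ; suc)
open import Data.Nat.GCD using (gcd)
open import Data.Nat.Primality using (Prime)
import Data.Nat.Properties as ℕₚ
open import Data.Product.Base using (Σ-syntax; ∃-syntax; _×_; _,_)
open import Data.Product.Relation.Binary.Pointwise.NonDependent using (×-setoid)
open import Data.Rational.Base as ℚ using (ℚ; 0ℚ; 1ℚ; ½)
import Data.Rational.Properties as ℚₚ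
open import Data.Rational.Solver using (module +-*-Solver)
open import Data.Sum.Base using (_⊎_; inj₁; inj₂)
open import Data.Vec.Functional as Vector using (Vector)
open import Relation.Binary.Bundles using (Setoid)
open import Relation.Binary.PropositionalEquality as ≡ using (_≡_)
open import Relation.Nullary using (¬_)
open import Relation.Unary using (Pred)

-- A subset P of a setoid is infinite when no finite list exhausts it (up to ≈).
Infinite : ∀ {a ℓ p} (S : Setoid a ℓ) → Pred (Setoid.Carrier S) p → Set (a ⊔ ℓ ⊔ p)
Infinite S P = ∀ (xs : List Carrier) → ∃[ x ] P x × x ∉ xs
  where
  open Setoid S using (Carrier)
  open Membership S using (_∉_)

------------------------------------------------------------------------
-- Dickson's conjecture

IsPrimeℤ : Pred ℤ 0ℓ
IsPrimeℤ z = ∃[ p ] Prime p × z ≡ ℤ.+ p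

∏ℤ : ∀ {k} → Vector ℤ k → ℤ
∏ℤ = Vector.foldr ℤ._*_ 1ℤ

DicksonConjecture : Set
DicksonConjecture =
  ∀ (k : ℕ) → 1 ℕ.≤ k →
  ∀ (a b : Vector ℤ k) → (∀ i → 1ℤ ℤ.≤ a i) →
  ¬ (∃[ ℓ ] Prime ℓ × (∀ (t : ℤ) → ℤ.+ ℓ ∣ℤ ∏ℤ (λ i → a i ℤ.* t ℤ.+ b i))) →
  Infinite (≡.setoid ℤ) (λ t → 0ℤ ℤ.< t × (∀ i → IsPrimeℤ (a i ℤ.* t ℤ.+ b i)))

------------------------------------------------------------------------
-- Estimates on ℚ

private
  0<½ : 0ℚ ℚ.< ½
  0<½ = ℚₚ.positive⁻¹ ½

  half : ∀ {ε} → 0ℚ ℚ.< ε → 0ℚ ℚ.< ½ ℚ.* ε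
  half {ε} 0<ε =
    ≡.subst (ℚ._< ½ ℚ.* ε) (ℚₚ.*-zeroʳ ½) (ℚₚ.*-monoʳ-<-pos ½ 0<ε)

  half+half : ∀ ε → ½ ℚ.* ε ℚ.+ ½ ℚ.* ε ≡ ε
  half+half ε = ≡.trans (≡.sym (ℚₚ.*-distribʳ-+ ε ½ ½)) (ℚₚ.*-identityˡ ε)

  open +-*-Solver using (solve; _:+_; _:*_; _:-_; :-_; _:=_)

  ∣a-b∣≡∣b-a∣ : ∀ a b → ℚ.∣ a ℚ.- b ∣ ≡ ℚ.∣ b ℚ.- a ∣
  ∣a-b∣≡∣b-a∣ a b = ≡.trans (≡.sym (ℚₚ.∣-p∣≡∣p∣ (a ℚ.- b)))
    (≡.cong ℚ.∣_∣ (solve 2 (λ a b → :- (a :- b) := b :- a) ≡.refl a b))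

  sum-bound : ∀ {ε} p q r → p ≡ q ℚ.+ r →
              ℚ.∣ q ∣ ℚ.< ½ ℚ.* ε → ℚ.∣ r ∣ ℚ.< ½ ℚ.* ε → ℚ.∣ p ∣ ℚ.< ε
  sum-bound {ε} p q r p≡q+r ∣q∣< ∣r∣< = begin-strict
    ℚ.∣ p ∣                ≡⟨ ≡.cong ℚ.∣_∣ p≡q+r ⟩
    ℚ.∣ q ℚ.+ r ∣          ≤⟨ ℚₚ.∣p+q∣≤∣p∣+∣q∣ q r ⟩
    ℚ.∣ q ∣ ℚ.+ ℚ.∣ r ∣    <⟨ ℚₚ.+-mono-< ∣q∣< ∣r∣< ⟩
    ½ ℚ.* ε ℚ.+ ½ ℚ.* ε    ≡⟨ half+half ε ⟩
    ε                      ∎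
    where open ℚₚ.≤-Reasoning

  ∣a∣≤∣b∣+∣a-b∣ : ∀ a b → ℚ.∣ a ∣ ℚ.≤ ℚ.∣ b ∣ ℚ.+ ℚ.∣ a ℚ.- b ∣
  ∣a∣≤∣b∣+∣a-b∣ a b = begin
    ℚ.∣ a ∣                        ≡⟨ ≡.cong ℚ.∣_∣ (solve 2 (λ a b → a := b :+ (a :- b)) ≡.refl a b) ⟩
    ℚ.∣ b ℚ.+ (a ℚ.- b) ∣          ≤⟨ ℚₚ.∣p+q∣≤∣p∣+∣q∣ b (a ℚ.- b) ⟩
    ℚ.∣ b ∣ ℚ.+ ℚ.∣ a ℚ.- b ∣      ∎
    where open ℚₚ.≤-Reasoning

  ∣a∣-∣b∣≤∣a-b∣ : ∀ a b → ℚ.∣ a ∣ ℚ.- ℚ.∣ b ∣ ℚ.≤ ℚ.∣ a ℚ.- b ∣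
  ∣a∣-∣b∣≤∣a-b∣ a b = begin
    ℚ.∣ a ∣ ℚ.- ℚ.∣ b ∣
      ≤⟨ ℚₚ.+-monoˡ-≤ (ℚ.- ℚ.∣ b ∣) (∣a∣≤∣b∣+∣a-b∣ a b) ⟩
    ℚ.∣ b ∣ ℚ.+ ℚ.∣ a ℚ.- b ∣ ℚ.- ℚ.∣ b ∣
      ≡⟨ solve 2 (λ x y → x :+ y :- x := y) ≡.refl ℚ.∣ b ∣ ℚ.∣ a ℚ.- b ∣ ⟩
    ℚ.∣ a ℚ.- b ∣ ∎
    where open ℚₚ.≤-Reasoning

  ∣∣a∣-∣b∣∣≤∣a-b∣ : ∀ a b → ℚ.∣ ℚ.∣ a ∣ ℚ.- ℚ.∣ b ∣ ∣ ℚ.≤ ℚ.∣ a ℚ.- b ∣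
  ∣∣a∣-∣b∣∣≤∣a-b∣ a b with ℚₚ.∣p∣≡p∨∣p∣≡-p (ℚ.∣ a ∣ ℚ.- ℚ.∣ b ∣)
  ... | inj₁ eq = ≡.subst (ℚ._≤ ℚ.∣ a ℚ.- b ∣) (≡.sym eq) (∣a∣-∣b∣≤∣a-b∣ a b)
  ... | inj₂ eq = ≡.subst₂ ℚ._≤_
    (≡.sym (≡.trans eq (solve 2 (λ x y → :- (x :- y) := y :- x) ≡.refl ℚ.∣ a ∣ ℚ.∣ b ∣)))
    (∣a-b∣≡∣b-a∣ b a) (∣a∣-∣b∣≤∣a-b∣ b a)

  -- With B > 0, the tolerance δ = ε/B satisfies B * δ = ε.
  divide : ∀ {ε} B → 0ℚ ℚ.< B → 0ℚ ℚ.< ε → Σ[ δ ∈ ℚ ] 0ℚ ℚ.< δ × B ℚ.* δ ≡ ε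
  divide {ε} B 0<B 0<ε = B⁻¹ ℚ.* ε , 0<δ , eq
    where
    instance
      B-pos : ℚ.Positive B
      B-pos = ℚ.positive 0<B
      B-nz : ℚ.NonZero B
      B-nz = ℚₚ.pos⇒nonZero B
    B⁻¹ : ℚ
    B⁻¹ = ℚ.1/ B
    0<δ : 0ℚ ℚ.< B⁻¹ ℚ.* ε
    0<δ = ≡.subst (ℚ._< B⁻¹ ℚ.* ε) (ℚₚ.*-zeroʳ B⁻¹)
            (ℚₚ.*-monoʳ-<-pos B⁻¹ {{ℚₚ.1/pos⇒pos B}} 0<ε)
    eq : B ℚ.* (B⁻¹ ℚ.* ε) ≡ ε
    eq = ≡.trans (≡.sym (ℚₚ.*-assoc B B⁻¹ ε))
           (≡.trans (≡.cong (ℚ._* ε) (ℚₚ.*-inverseʳ B)) (ℚₚ.*-identityˡ ε))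

  product-bound : ∀ {ε B δ} a b → 0ℚ ℚ.< B → B ℚ.* δ ≡ ε →
                  ℚ.∣ a ∣ ℚ.< B → ℚ.∣ b ∣ ℚ.< δ → ℚ.∣ a ℚ.* b ∣ ℚ.< ε
  product-bound {ε} {B} {δ} a b 0<B Bδ≡ε ∣a∣<B ∣b∣<δ = begin-strict
    ℚ.∣ a ℚ.* b ∣          ≡⟨ ℚₚ.∣p*q∣≡∣p∣*∣q∣ a b ⟩
    ℚ.∣ a ∣ ℚ.* ℚ.∣ b ∣    ≤⟨ ℚₚ.*-monoʳ-≤-nonNeg ℚ.∣ b ∣ {{ℚₚ.∣-∣-nonNeg b}} (ℚₚ.<⇒≤ ∣a∣<B) ⟩
    B ℚ.* ℚ.∣ b ∣          <⟨ ℚₚ.*-monoʳ-<-pos B {{ℚ.positive 0<B}} ∣b∣<δ ⟩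
    B ℚ.* δ                ≡⟨ Bδ≡ε ⟩
    ε                      ∎
    where open ℚₚ.≤-Reasoning

  ⊔ˡ : ∀ {M N n} → M ℕ.⊔ N ℕ.≤ n → M ℕ.≤ n
  ⊔ˡ {M} {N} = ℕₚ.≤-trans (ℕₚ.m≤m⊔n M N)

  ⊔ʳ : ∀ {M N n} → M ℕ.⊔ N ℕ.≤ n → N ℕ.≤ n
  ⊔ʳ {M} {N} = ℕₚ.≤-trans (ℕₚ.m≤n⊔m M N)

------------------------------------------------------------------------
-- Real numbers: Cauchy sequences of rationals, equipped with a modulus

IsCauchy : Pred (ℕ → ℚ) 0ℓ
IsCauchy s = ∀ (ε : ℚ) → 0ℚ ℚ.< ε →
  ∃[ N ] (∀ m n → N ℕ.≤ m → N ℕ.≤ n → ℚ.∣ s m ℚ.- s n ∣ ℚ.< ε)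

record ℝ : Set where
  constructor mkℝ
  field
    seq    : ℕ → ℚ
    cauchy : IsCauchy seq

open ℝ public

infix  4 _≈ℝ_ _<ℝ_ _#ℝ_
infixl 6 _+ℝ_ _-ℝ_
infixl 7 _*ℝ_
infix  8 -ℝ_

_≈ℝ_ : ℝ → ℝ → Set
x ≈ℝ y = ∀ (ε : ℚ) → 0ℚ ℚ.< ε →
  ∃[ N ] (∀ n → N ℕ.≤ n → ℚ.∣ seq x n ℚ.- seq y n ∣ ℚ.< ε)

_<ℝ_ : ℝ → ℝ → Set
x <ℝ y = Σ[ δ ∈ ℚ ] 0ℚ ℚ.< δ ×
  ∃[ N ] (∀ n → N ℕ.≤ n → seq x n ℚ.+ δ ℚ.< seq y n)

-- The constructive form of x ≠ y.
_#ℝ_ : ℝ → ℝ → Set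
x #ℝ y = x <ℝ y ⊎ y <ℝ x

fromℚ : ℚ → ℝ
fromℚ q = mkℝ (λ _ → q) λ ε 0<ε → 0 , λ _ _ _ _ →
  ≡.subst (ℚ._< ε) (≡.sym (≡.cong ℚ.∣_∣ (ℚₚ.+-inverseʳ q))) 0<ε

0ℝ 1ℝ : ℝ
0ℝ = fromℚ 0ℚ
1ℝ = fromℚ 1ℚ

_+ℝ_ : ℝ → ℝ → ℝ
x +ℝ y = mkℝ (λ n → seq x n ℚ.+ seq y n) λ ε 0<ε →
  let M , hx = cauchy x (½ ℚ.* ε) (half 0<ε)
      N , hy = cauchy y (½ ℚ.* ε) (half 0<ε)
  in M ℕ.⊔ N , λ m n ≤m ≤n →
    sum-bound _ (seq x m ℚ.- seq x n) (seq y m ℚ.- seq y n)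
      (solve 4 (λ a b c d → a :+ b :- (c :+ d) := a :- c :+ (b :- d)) ≡.refl
         (seq x m) (seq y m) (seq x n) (seq y n))
      (hx m n (⊔ˡ ≤m) (⊔ˡ ≤n)) (hy m n (⊔ʳ {M} ≤m) (⊔ʳ {M} ≤n))

-ℝ_ : ℝ → ℝ
-ℝ x = mkℝ (λ n → ℚ.- seq x n) λ ε 0<ε →
  let N , hx = cauchy x ε 0<ε
  in N , λ m n ≤m ≤n → ≡.subst (ℚ._< ε)
       (≡.trans (∣a-b∣≡∣b-a∣ (seq x m) (seq x n)) (≡.cong ℚ.∣_∣
         (solve 2 (λ a b → b :- a := :- a :- (:- b)) ≡.refl (seq x m) (seq x n))))
       (hx m n ≤m ≤n)

_-ℝ_ : ℝ → ℝ → ℝ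
x -ℝ y = x +ℝ -ℝ y

∣_∣ℝ : ℝ → ℝ
∣ x ∣ℝ = mkℝ (λ n → ℚ.∣ seq x n ∣) λ ε 0<ε →
  let N , hx = cauchy x ε 0<ε
  in N , λ m n ≤m ≤n →
       ℚₚ.≤-<-trans (∣∣a∣-∣b∣∣≤∣a-b∣ (seq x m) (seq x n)) (hx m n ≤m ≤n)

private
  eventually-bounded : ∀ x → Σ[ B ∈ ℚ ] 0ℚ ℚ.< B ×
                       ∃[ N ] (∀ n → N ℕ.≤ n → ℚ.∣ seq x n ∣ ℚ.< B)
  eventually-bounded x with cauchy x 1ℚ (ℚₚ.positive⁻¹ 1ℚ)
  ... | N , h = B , 0<B , N , λ n N≤n →
          ℚₚ.≤-<-trans (∣a∣≤∣b∣+∣a-b∣ (seq x n) (seq x N))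
            (ℚₚ.+-monoʳ-< ℚ.∣ seq x N ∣ (h n N N≤n ℕₚ.≤-refl))
    where
    B : ℚ
    B = ℚ.∣ seq x N ∣ ℚ.+ 1ℚ
    0<B : 0ℚ ℚ.< B
    0<B = ℚₚ.+-mono-≤-< (ℚₚ.0≤∣p∣ (seq x N)) (ℚₚ.positive⁻¹ 1ℚ)

_*ℝ_ : ℝ → ℝ → ℝ
x *ℝ y = mkℝ (λ n → seq x n ℚ.* seq y n) λ ε 0<ε →
  let Bx , 0<Bx , Nx , bx = eventually-bounded x
      By , 0<By , Ny , by = eventually-bounded y
      δy , 0<δy , eqy     = divide Bx 0<Bx (half 0<ε)
      δx , 0<δx , eqx     = divide By 0<By (half 0<ε)
      Mx , hx             = cauchy x δx 0<δx
      My , hy             = cauchy y δy 0<δy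
  in (Nx ℕ.⊔ Ny) ℕ.⊔ (Mx ℕ.⊔ My) , λ m n ≤m ≤n →
    sum-bound _
      (seq x m ℚ.* (seq y m ℚ.- seq y n)) (seq y n ℚ.* (seq x m ℚ.- seq x n))
      (solve 4 (λ a b c d → a :* b :- c :* d := a :* (b :- d) :+ d :* (a :- c)) ≡.refl
         (seq x m) (seq y m) (seq x n) (seq y n))
      (product-bound (seq x m) (seq y m ℚ.- seq y n) 0<Bx eqy
        (bx m (⊔ˡ (⊔ˡ ≤m)))
        (hy m n (⊔ʳ {Mx} (⊔ʳ {Nx ℕ.⊔ Ny} ≤m)) (⊔ʳ {Mx} (⊔ʳ {Nx ℕ.⊔ Ny} ≤n))))
      (product-bound (seq y n) (seq x m ℚ.- seq x n) 0<By eqx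
        (by n (⊔ʳ {Nx} (⊔ˡ ≤n)))
        (hx m n (⊔ˡ (⊔ʳ {Nx ℕ.⊔ Ny} ≤m)) (⊔ˡ (⊔ʳ {Nx ℕ.⊔ Ny} ≤n))))

ℝ-setoid : Setoid 0ℓ 0ℓ
ℝ-setoid = record
  { Carrier = ℝ
  ; _≈_     = _≈ℝ_
  ; isEquivalence = record
    { refl  = λ {x} ε 0<ε → 0 , λ n _ →
        ≡.subst (ℚ._< ε) (≡.sym (≡.cong ℚ.∣_∣ (ℚₚ.+-inverseʳ (seq x n)))) 0<ε
    ; sym   = λ {x} {y} x≈y ε 0<ε →
        let N , h = x≈y ε 0<ε
        in N , λ n ≤n → ≡.subst (ℚ._< ε) (∣a-b∣≡∣b-a∣ (seq x n) (seq y n)) (h n ≤n)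
    ; trans = λ {x} {y} {z} x≈y y≈z ε 0<ε →
        let M , h = x≈y (½ ℚ.* ε) (half 0<ε)
            N , k = y≈z (½ ℚ.* ε) (half 0<ε)
        in M ℕ.⊔ N , λ n ≤n →
          sum-bound _ (seq x n ℚ.- seq y n) (seq y n ℚ.- seq z n)
            (solve 3 (λ a b c → a :- c := a :- b :+ (b :- c)) ≡.refl
               (seq x n) (seq y n) (seq z n))
            (h n (⊔ˡ ≤n)) (k n (⊔ʳ {M} ≤n))
    }
  }

------------------------------------------------------------------------
-- Complex numbers

record ℂ : Set where
  constructor _+i_
  field
    re im : ℝ

open ℂ public

infix 4 _≈ℂ_ _#ℂ_

_≈ℂ_ : ℂ → ℂ → Set
z ≈ℂ w = re z ≈ℝ re w × im z ≈ℝ im w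

-- The constructive form of z ≠ w.
_#ℂ_ : ℂ → ℂ → Set
z #ℂ w = re z #ℝ re w ⊎ im z #ℝ im w

ofℝ : ℝ → ℂ
ofℝ x = x +i 0ℝ

ℂ-rawRing : RawRing 0ℓ 0ℓ
ℂ-rawRing = record
  { Carrier = ℂ
  ; _≈_     = _≈ℂ_
  ; _+_     = λ z w → (re z +ℝ re w) +i (im z +ℝ im w)
  ; _*_     = λ z w → (re z *ℝ re w -ℝ im z *ℝ im w) +i (re z *ℝ im w +ℝ im z *ℝ re w)
  ; -_      = λ z → (-ℝ re z) +i (-ℝ im z)
  ; 0#      = ofℝ 0ℝ
  ; 1#      = ofℝ 1ℝ
  }

open RawRing ℂ-rawRing using (rawSemiring)
  renaming (_+_ to _+ℂ_; _*_ to _*ℂ_; -_ to -ℂ_; 1# to 1ℂ) public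
open RawSemiringDefinitions rawSemiring using () renaming (_^_ to _^ℂ_) public

------------------------------------------------------------------------
-- Cyclotomic polynomials

IsPrimitiveRoot : ℕ → ℂ → Set
IsPrimitiveRoot n ζ =
  ζ ^ℂ n ≈ℂ 1ℂ × (∀ k → 1 ℕ.≤ k → k ℕ.< n → ζ ^ℂ k #ℂ 1ℂ)

totatives : ℕ → List ℕ
totatives n = filter (λ a → gcd a n ℕₚ.≟ 1) (map suc (upTo n))

-- The value at z of the n-th cyclotomic polynomial, written with the primitive
-- n-th root of unity ζ.
Φ : (n : ℕ) (ζ : ℂ) → ℂ → ℂ
Φ n ζ z = foldr _*ℂ_ 1ℂ (map (λ a → z +ℂ -ℂ (ζ ^ℂ a)) (totatives n))

-- Φ_m(x) = Φ_n(x).  The polynomials do not depend on the choice of the primitive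
-- roots of unity, so the equation is asked for every choice of them.
CyclotomicValuesAgree : ℕ → ℕ → ℝ → Set
CyclotomicValuesAgree m n x =
  ∀ ζ ξ → IsPrimitiveRoot m ζ → IsPrimitiveRoot n ξ →
  Φ m ζ (ofℝ x) ≈ℂ Φ n ξ (ofℝ x)

Triples : Setoid 0ℓ 0ℓ
Triples = ×-setoid (≡.setoid ℕ) (×-setoid (≡.setoid ℕ) ℝ-setoid)

{-# OPTIONS --safe #-}

-- Let p, q, r be large primes with p + q + r = q r, that is p = (q - 1)(r - 1) - 1; for a fixed
-- prime q Dickson's conjecture provides infinitely many such pairs (p, r).  Since
--   Φ_p(x) (x - 1) = x^p - 1  and  Φ_qr(x) (x^q - 1) (x^r - 1) = (x^qr - 1) (x - 1),
-- the equation Φ_p(x) = Φ_qr(x) amounts, for x > 1, to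
--   (x^p - 1) (x^q - 1) (x^r - 1) = (x^qr - 1) (x - 1)^2.
-- Divided by x^qr, the left-hand side is close to 1 and the right-hand side to (x - 1)^2 when
-- p, q, r are large: the left-hand side is smaller at x = 2 and larger at x = 2 - 3η for small
-- η > 0, so bisection finds a root between these two points.
-- The product formulas hold for every primitive root ζ because a monic polynomial of degree n
-- is the product of its n linear factors once the differences of the roots can be cancelled.

module Submission where

open import Defs
open import Algebra.Bundles using (CommutativeRing)
import Algebra.Solver.Ring.NaturalCoefficients.Default as NaturalCoefficients
open import Data.Bool.Base using (Bool; true; false; not; _∧_)
open import Data.Integer.Base as ℤ using (ℤ; 0ℤ; 1ℤ)
import Data.Integer.Properties as ℤₚ
open import Data.Fin.Base using (zero; suc)
open import Data.List.Base using (List; []; _∷_; applyUpTo; filter; foldr; map; upTo)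
open import Data.List.Membership.Propositional using (_∉_)
open import Data.List.Membership.Propositional.Properties using (∈-map⁺; ∈-upTo⁺)
import Data.List.Membership.Setoid as Membership
open import Data.List.Properties using (map-upTo)
open import Data.List.Relation.Unary.Any using (here; there)
open import Data.Nat.Base as ℕ using (ℕ; zero; suc; _≤_; NonZero; z≤n; s≤s; z<s; s<s)
open import Data.Nat.Coprimality as Coprimality using (Coprime; coprime⇒gcd≡1; gcd≡1⇒coprime; coprime-divisor)
open import Data.Nat.Divisibility using (_∣_; _∣?_; divides; ∣-refl; ∣-trans; ∣⇒≤; ∣1⇒≡1; m∣m*n; n∣m*n; *-monoʳ-∣; ∣m+n∣m⇒∣n; ∣m∣n⇒∣m+n)
open import Data.Nat.GCD using (gcd)
open import Data.Nat.Primality using (Prime; prime⇒irreducible; prime⇒nonZero; ¬prime[1])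
import Data.Nat.Properties as ℕₚ
open import Data.Product.Base using (Σ-syntax; ∃-syntax; _×_; _,_; proj₁; proj₂)
open import Data.Rational.Base as ℚ using (ℚ; 0ℚ; 1ℚ; ½; mkℚ)
import Data.Rational.Properties as ℚₚ
open import Data.Rational.Solver using (module +-*-Solver)
import Data.Rational.Unnormalised.Base as ℚᵘ
import Data.Rational.Unnormalised.Properties as ℚᵘₚ
open import Data.Sum.Base using (_⊎_; inj₁; inj₂)
open import Data.Vec.Base using (Vec; []; _∷_; replicate)
import Data.Vec.Functional as Vector
open import Function.Base using (_∘_)
open import Function.Bundles using (mk⇔)
open import Level using (0ℓ)
open import Relation.Binary.Bundles using (Setoid)
open import Relation.Binary.PropositionalEquality as ≡ using (_≡_; _≢_)
open import Relation.Nullary using (¬_; does; contradiction; ¬?; _×-dec_)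
open import Relation.Nullary.Decidable using (does-⇔; dec-true; dec-false)
open import Relation.Unary using (Pred; Decidable)

-- Products over roots of unity in a commutative ring

module RootsOfUnity {c ℓ} (R : CommutativeRing c ℓ) where

  open CommutativeRing R
  open import Algebra.Properties.CommutativeSemigroup *-commutativeSemigroup using (interchange)
  open import Algebra.Properties.Ring ring using (x[y-z]≈xy-xz; x∙y⁻¹≈ε⇒x≈y; x≈y⇒x∙y⁻¹≈ε; //-rightDividesˡ)
  open import Algebra.Properties.CommutativeSemiring.Exp commutativeSemiring using (_^_; ^-congˡ; ^-congʳ; ^-homo-*; ^-assocʳ)
  open import Relation.Binary.Reasoning.Setoid setoid
  open NaturalCoefficients commutativeSemiring using (solve; _:+_; _:*_; _:=_)

  -- Trivial annihilator is the form of being nonzero that survives in a ring without a zero test;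
  -- over ℂ it comes from apartness, by `#⇒cancellable`.
  Cancellable : Carrier → Set _
  Cancellable a = ∀ b → a * b ≈ 0# → b ≈ 0#

  cancel-cong : ∀ {a b} → a ≈ b → Cancellable a → Cancellable b
  cancel-cong a≈b cancel c bc≈0 = cancel c (trans (*-congʳ a≈b) bc≈0)

  cancel-* : ∀ {a b} → Cancellable a → Cancellable b → Cancellable (a * b)
  cancel-* {a} {b} cancel-a cancel-b c abc≈0 =
    cancel-b c (cancel-a (b * c) (trans (sym (*-assoc a b c)) abc≈0))

  cancel-^ : ∀ {a} → Cancellable a → ∀ n → Cancellable (a ^ n)
  cancel-^ cancel zero    c 1c≈0 = trans (sym (*-identityˡ c)) 1c≈0
  cancel-^ cancel (suc n) = cancel-* cancel (cancel-^ cancel n)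

  cancel-unit : ∀ {a b} → a * b ≈ 1# → Cancellable a
  cancel-unit {a} {b} ab≈1 c ac≈0 = begin
    c            ≈⟨ *-identityˡ c ⟨
    1# * c       ≈⟨ *-congʳ ab≈1 ⟨
    a * b * c    ≈⟨ *-congʳ (*-comm a b) ⟩
    b * a * c    ≈⟨ *-assoc b a c ⟩
    b * (a * c)  ≈⟨ *-congˡ ac≈0 ⟩
    b * 0#       ≈⟨ zeroʳ b ⟩
    0#           ∎

  *-cancelˡ : ∀ {a} → Cancellable a → ∀ {b c} → a * b ≈ a * c → b ≈ c
  *-cancelˡ {a} cancel {b} {c} ab≈ac = x∙y⁻¹≈ε⇒x≈y b c
    (cancel (b - c) (trans (x[y-z]≈xy-xz a b c) (x≈y⇒x∙y⁻¹≈ε ab≈ac)))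

  1^n≈1 : ∀ n → 1# ^ n ≈ 1#
  1^n≈1 zero    = refl
  1^n≈1 (suc n) = trans (*-identityˡ (1# ^ n)) (1^n≈1 n)

  -- Finite products and their restriction to multiples

  ∏ : ℕ → (ℕ → Carrier) → Carrier
  ∏ zero    f = 1#
  ∏ (suc n) f = f 0 * ∏ n (f ∘ suc)

  ∏-cong : ∀ n {f g : ℕ → Carrier} → (∀ i → i ℕ.< n → f i ≈ g i) → ∏ n f ≈ ∏ n g
  ∏-cong zero    f≈g = refl
  ∏-cong (suc n) f≈g = *-cong (f≈g 0 z<s) (∏-cong n λ i i<n → f≈g (suc i) (s<s i<n))

  ∏-* : ∀ n (f g : ℕ → Carrier) → ∏ n (λ i → f i * g i) ≈ ∏ n f * ∏ n g
  ∏-* zero    f g = sym (*-identityˡ 1#)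
  ∏-* (suc n) f g = trans (*-congˡ (∏-* n (f ∘ suc) (g ∘ suc)))
                          (interchange (f 0) (g 0) (∏ n (f ∘ suc)) (∏ n (g ∘ suc)))

  ∏-+ : ∀ m n (f : ℕ → Carrier) → ∏ (m ℕ.+ n) f ≈ ∏ m f * ∏ n (λ i → f (m ℕ.+ i))
  ∏-+ zero    n f = sym (*-identityˡ _)
  ∏-+ (suc m) n f = trans (*-congˡ (∏-+ m n (f ∘ suc))) (sym (*-assoc _ _ _))

  ∏-last : ∀ n (f : ℕ → Carrier) → (∀ i → i ℕ.< n → f i ≈ 1#) → ∏ (suc n) f ≈ f n
  ∏-last zero    f f≈1 = *-identityʳ (f 0)
  ∏-last (suc n) f f≈1 = begin
    f 0 * ∏ (suc n) (f ∘ suc)  ≈⟨ *-cong (f≈1 0 z<s) (∏-last n (f ∘ suc) λ i i<n → f≈1 (suc i) (s<s i<n)) ⟩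
    1# * f (suc n)             ≈⟨ *-identityˡ _ ⟩
    f (suc n)                  ∎

  infixr 8 _if_
  -- Padding with 1 gives products over different conditions the same index range, so that they
  -- multiply factor by factor.
  _if_ : Carrier → Bool → Carrier
  x if true  = x
  x if false = 1#

  if-cong : ∀ {x y} → x ≈ y → ∀ b → x if b ≈ y if b
  if-cong x≈y true  = x≈y
  if-cong x≈y false = refl

  ∏-filter : ∀ {p} {P : Pred ℕ p} (P? : Decidable P) (f : ℕ → Carrier) (s : ℕ → ℕ) n →
             foldr _*_ 1# (map f (filter P? (applyUpTo s n))) ≈
             ∏ n (λ i → f (s i) if does (P? (s i)))
  ∏-filter P? f s zero = refl
  ∏-filter P? f s (suc n) with does (P? (s 0))
  ... | true  = *-congˡ (∏-filter P? f (s ∘ suc) n)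
  ... | false = trans (∏-filter P? f (s ∘ suc) n) (sym (*-identityˡ _))

  -- The range splits into k blocks of length d. As the index i stands for the number `suc i`,
  -- exactly the last factor of each block survives.
  ∏-multiples : ∀ d .{{_ : NonZero d}} k (g : ℕ → Carrier) →
                ∏ (k ℕ.* d) (λ i → g (suc i) if does (d ∣? suc i)) ≈
                ∏ k (λ i → g (suc i ℕ.* d))
  ∏-multiples d zero g = refl
  ∏-multiples d@(suc d-1) (suc k) g = begin
    ∏ (d ℕ.+ k ℕ.* d) h                                 ≈⟨ ∏-+ d (k ℕ.* d) h ⟩
    ∏ d h * ∏ (k ℕ.* d) (λ i → h (d ℕ.+ i))             ≈⟨ *-cong first-block later-blocks ⟩
    g (1 ℕ.* d) * ∏ k (λ i → g (suc (suc i) ℕ.* d))     ∎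
    where
    h : ℕ → Carrier
    h i = g (suc i) if does (d ∣? suc i)

    -- Shifting by d preserves divisibility by d, so the induction hypothesis applies to the shifted
    -- function.
    g′ : ℕ → Carrier
    g′ a = g (d ℕ.+ a)

    first-block : ∏ d h ≈ g (1 ℕ.* d)
    first-block = begin
      ∏ d h        ≈⟨ ∏-last d-1 h (λ i i<d-1 → reflexive (≡.cong (g (suc i) if_)
                        (dec-false (d ∣? suc i) λ d∣1+i → ℕₚ.<⇒≱ (s<s i<d-1) (∣⇒≤ d∣1+i)))) ⟩
      h d-1        ≡⟨ ≡.cong (g d if_) (dec-true (d ∣? d) ∣-refl) ⟩
      g d          ≡⟨ ≡.cong g (ℕₚ.*-identityˡ d) ⟨
      g (1 ℕ.* d)  ∎

    later-blocks : ∏ (k ℕ.* d) (λ i → h (d ℕ.+ i)) ≈ ∏ k (λ i → g (suc (suc i) ℕ.* d))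
    later-blocks = begin
      ∏ (k ℕ.* d) (λ i → h (d ℕ.+ i))
        ≈⟨ ∏-cong (k ℕ.* d) (λ i _ → reflexive (≡.cong₂ _if_
             (≡.cong g (≡.sym (ℕₚ.+-suc d i)))
             (≡.trans (≡.cong (λ a → does (d ∣? a)) (≡.sym (ℕₚ.+-suc d i)))
                (does-⇔ (mk⇔ (λ d∣d+a → ∣m+n∣m⇒∣n d∣d+a ∣-refl) (∣m∣n⇒∣m+n ∣-refl))
                        (d ∣? (d ℕ.+ suc i)) (d ∣? suc i))))) ⟩
      ∏ (k ℕ.* d) (λ i → g′ (suc i) if does (d ∣? suc i))
        ≈⟨ ∏-multiples d k g′ ⟩
      ∏ k (λ i → g (suc (suc i) ℕ.* d)) ∎

  -- Monic polynomials, given by their lower coefficients (constant term first)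

  eval : ∀ {n} → Vec Carrier n → Carrier → Carrier
  eval []       z = 1#
  eval (c ∷ cs) z = c + z * eval cs z

  -- Horner's scheme: the coefficients of the quotient are the values at a of the successive tails
  -- of `cs`.
  synthetic-division : ∀ {n} (cs : Vec Carrier (suc n)) a →
    Σ[ ds ∈ Vec Carrier n ] ∀ z → eval cs z ≈ (z - a) * eval ds z + eval cs a
  -- Keeping `z - a` as a single atom and rewriting z as `z - a + a` makes the identities free of
  -- subtraction, as the semiring solver requires.
  synthetic-division (c ∷ []) a = [] , λ z → begin
    c + z * 1#                           ≈⟨ +-congˡ (*-congʳ (//-rightDividesˡ a z)) ⟨
    c + (z - a + a) * 1#                 ≈⟨ solve 4 (λ c e a u → c :+ (e :+ a) :* u := e :* u :+ (c :+ a :* u)) refl c (z - a) a 1# ⟩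
    (z - a) * 1# + (c + a * 1#)          ∎
  synthetic-division (c ∷ cs@(_ ∷ _)) a with synthetic-division cs a
  ... | ds , division = eval cs a ∷ ds , λ z → let e = z - a ; d = eval ds z ; r = eval cs a in begin
    c + z * eval cs z                    ≈⟨ +-congˡ (*-congˡ (division z)) ⟩
    c + z * (e * d + r)                  ≈⟨ solve 5 (λ c z e d r → c :+ z :* (e :* d :+ r) := c :+ (z :* e :* d :+ z :* r)) refl c z e d r ⟩
    c + (z * e * d + z * r)              ≈⟨ +-congˡ (+-congˡ (*-congʳ (//-rightDividesˡ a z))) ⟨
    c + (z * e * d + (e + a) * r)        ≈⟨ solve 6 (λ c z e d r a → c :+ (z :* e :* d :+ (e :+ a) :* r) := e :* (r :+ z :* d) :+ (c :+ a :* r)) refl c z e d r a ⟩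
    e * (r + z * d) + (c + a * r)        ∎

  -- Roots are split off one at a time. A later root annihilates the product of `r (suc i) - r 0`
  -- with the quotient; the difference is cancellable, so it is a root of the quotient.
  factor : ∀ {n} (cs : Vec Carrier n) (r : ℕ → Carrier) →
           (∀ i → i ℕ.< n → eval cs (r i) ≈ 0#) →
           (∀ i j → i ℕ.< j → j ℕ.< n → Cancellable (r j - r i)) →
           ∀ z → eval cs z ≈ ∏ n (λ i → z - r i)
  factor [] r root separated z = refl
  factor {suc n} cs@(_ ∷ _) r root separated z with synthetic-division cs (r 0)
  ... | ds , division = begin
    eval cs z                                ≈⟨ division′ z ⟩
    (z - r 0) * eval ds z                    ≈⟨ *-congˡ (factor ds (r ∘ suc)
      (λ i i<n → separated 0 (suc i) z<s (s<s i<n) (eval ds (r (suc i)))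
        (trans (sym (division′ (r (suc i)))) (root (suc i) (s<s i<n))))
      (λ i j i<j j<n → separated (suc i) (suc j) (s<s i<j) (s<s j<n)) z) ⟩
    (z - r 0) * ∏ n (λ i → z - r (suc i))    ∎
    where
    division′ : ∀ z → eval cs z ≈ (z - r 0) * eval ds z
    division′ z = trans (division z) (trans (+-congˡ (root 0 z<s)) (+-identityʳ _))

  -- Primitive roots of unity and the factors of z^n - 1

  eval-0 : ∀ n z → eval (replicate n 0#) z ≈ z ^ n
  eval-0 zero    z = refl
  eval-0 (suc n) z = trans (+-identityˡ _) (*-congˡ (eval-0 n z))

  -- Exact order n is expressed by cancellability, because that is how it enters `factor`.
  PrimitiveRoot : ℕ → Carrier → Set _
  PrimitiveRoot n ζ = ζ ^ n ≈ 1# × (∀ k → 1 ℕ.≤ k → k ℕ.< n → Cancellable (ζ ^ k - 1#))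

  -- The powers of ζ with exponents 1 to n are n roots of z^n - 1, and the difference of two of them
  -- is a power of ζ times some `ζ ^ k - 1#` with 1 ≤ k < n.
  ∏[z-ζ^a]≈z^n-1 : ∀ n .{{_ : NonZero n}} ζ → PrimitiveRoot n ζ →
                    ∀ z → ∏ n (λ i → z - ζ ^ suc i) ≈ z ^ n - 1#
  ∏[z-ζ^a]≈z^n-1 n@(suc n-1) ζ (ζ^n≈1 , order) z =
    trans (sym (factor cs (λ i → ζ ^ suc i) root separated z)) (eval-cs z)
    where
    cs : Vec Carrier n
    cs = - 1# ∷ replicate n-1 0#

    eval-cs : ∀ z → eval cs z ≈ z ^ n - 1#
    eval-cs z = trans (+-comm (- 1#) _) (+-congʳ (*-congˡ (eval-0 n-1 z)))

    root : ∀ i → i ℕ.< n → eval cs (ζ ^ suc i) ≈ 0#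
    root i _ = trans (eval-cs (ζ ^ suc i)) (x≈y⇒x∙y⁻¹≈ε (begin
      (ζ ^ suc i) ^ n        ≈⟨ ^-assocʳ ζ (suc i) n ⟩
      ζ ^ (suc i ℕ.* n)      ≈⟨ ^-congʳ ζ (ℕₚ.*-comm (suc i) n) ⟩
      ζ ^ (n ℕ.* suc i)      ≈⟨ ^-assocʳ ζ n (suc i) ⟨
      (ζ ^ n) ^ suc i        ≈⟨ ^-congˡ (suc i) ζ^n≈1 ⟩
      1# ^ suc i             ≈⟨ 1^n≈1 (suc i) ⟩
      1#                     ∎))

    separated : ∀ i j → i ℕ.< j → j ℕ.< n → Cancellable (ζ ^ suc j - ζ ^ suc i)
    separated i j i<j j<n = cancel-cong
      (begin
        ζ ^ suc i * (ζ ^ (j ℕ.∸ i) - 1#)               ≈⟨ x[y-z]≈xy-xz _ _ _ ⟩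
        ζ ^ suc i * ζ ^ (j ℕ.∸ i) - ζ ^ suc i * 1#     ≈⟨ +-cong (sym (^-homo-* ζ (suc i) (j ℕ.∸ i))) (-‿cong (*-identityʳ _)) ⟩
        ζ ^ (suc i ℕ.+ (j ℕ.∸ i)) - ζ ^ suc i          ≡⟨ ≡.cong (λ k → ζ ^ suc k - ζ ^ suc i) (ℕₚ.m+[n∸m]≡n (ℕₚ.<⇒≤ i<j)) ⟩
        ζ ^ suc j - ζ ^ suc i                          ∎)
      -- Here `ζ^n≈1` reads as ζ times `ζ ^ n-1` being 1, which exhibits an inverse of ζ.
      (cancel-* (cancel-^ (cancel-unit ζ^n≈1) (suc i))
        (order (j ℕ.∸ i) (ℕₚ.m<n⇒0<n∸m i<j) (ℕₚ.≤-<-trans (ℕₚ.m∸n≤m j i) j<n)))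

  primitive-^ : ∀ d k .{{_ : NonZero d}} ζ → PrimitiveRoot (k ℕ.* d) ζ → PrimitiveRoot k (ζ ^ d)
  primitive-^ d k ζ (ζ^n≈1 , order) =
    trans (power k) ζ^n≈1 ,
    λ j 1≤j j<k → cancel-cong (+-congʳ (sym (power j)))
      (order (j ℕ.* d) (ℕₚ.*-mono-≤ 1≤j (ℕ.>-nonZero⁻¹ d)) (ℕₚ.*-monoˡ-< d j<k))
    where
    power : ∀ j → (ζ ^ d) ^ j ≈ ζ ^ (j ℕ.* d)
    power j = trans (^-assocʳ ζ d j) (^-congʳ ζ (ℕₚ.*-comm d j))

  -- The exponents divisible by d give the powers of ζ^d, which is a primitive k-th root of unity.
  ∏-multiples[z-ζ^a] : ∀ {n} d k .{{_ : NonZero d}} .{{_ : NonZero k}} → n ≡ k ℕ.* d →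
    ∀ ζ → PrimitiveRoot n ζ → ∀ z →
    ∏ n (λ i → (z - ζ ^ suc i) if does (d ∣? suc i)) ≈ z ^ k - 1#
  ∏-multiples[z-ζ^a] d k ≡.refl ζ order z = begin
    ∏ (k ℕ.* d) (λ i → (z - ζ ^ suc i) if does (d ∣? suc i))
      ≈⟨ ∏-multiples d k (λ a → z - ζ ^ a) ⟩
    ∏ k (λ i → z - ζ ^ (suc i ℕ.* d))
      ≈⟨ ∏-cong k (λ i _ → +-congˡ (-‿cong (trans (^-congʳ ζ (ℕₚ.*-comm (suc i) d)) (sym (^-assocʳ ζ d (suc i)))))) ⟩
    ∏ k (λ i → z - (ζ ^ d) ^ suc i)
      ≈⟨ ∏[z-ζ^a]≈z^n-1 k (ζ ^ d) (primitive-^ d k ζ order) z ⟩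
    z ^ k - 1# ∎

-- Cyclotomic values at prime and semiprime indices

prime⇒≢1 : ∀ {p} → Prime p → p ≢ 1
prime⇒≢1 p-prime ≡.refl = ¬prime[1] p-prime

coprime-prime : ∀ {p a} → Prime p → ¬ p ∣ a → Coprime a p
coprime-prime p-prime p∤a (d∣a , d∣p) with prime⇒irreducible p-prime d∣p
... | inj₁ d≡1    = d≡1
... | inj₂ ≡.refl = contradiction d∣a p∤a

coprime⇒∤ : ∀ {p a n} → Prime p → p ∣ n → gcd a n ≡ 1 → ¬ p ∣ a
coprime⇒∤ p-prime p∣n gcd≡1 p∣a = prime⇒≢1 p-prime (gcd≡1⇒coprime gcd≡1 (p∣a , p∣n))

distinct-primes-coprime : ∀ {q r} → Prime q → Prime r → q ≢ r → Coprime q r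
distinct-primes-coprime q-prime r-prime q≢r = coprime-prime r-prime r∤q
  where
  r∤q : ¬ _ ∣ _
  r∤q r∣q with prime⇒irreducible q-prime r∣q
  ... | inj₁ r≡1 = prime⇒≢1 r-prime r≡1
  ... | inj₂ r≡q = q≢r (≡.sym r≡q)

totative-prime : ∀ {p} → Prime p → ∀ a → does (gcd a p ℕₚ.≟ 1) ≡ not (does (p ∣? a))
totative-prime {p} p-prime a = does-⇔
  (mk⇔ (coprime⇒∤ p-prime ∣-refl) (λ p∤a → coprime⇒gcd≡1 (coprime-prime p-prime p∤a)))
  (gcd a p ℕₚ.≟ 1) (¬? (p ∣? a))

-- If q does not divide a, a common divisor of a and qr is coprime to q, hence divides r; if r does
-- not divide a either, it is 1.
totative-semiprime : ∀ {q r} → Prime q → Prime r → ∀ a →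
  does (gcd a (q ℕ.* r) ℕₚ.≟ 1) ≡ not (does (q ∣? a)) ∧ not (does (r ∣? a))
totative-semiprime {q} {r} q-prime r-prime a = does-⇔
  (mk⇔ (λ gcd≡1 → coprime⇒∤ q-prime (m∣m*n r) gcd≡1 , coprime⇒∤ r-prime (n∣m*n q) gcd≡1)
       (λ (q∤a , r∤a) → coprime⇒gcd≡1 λ (d∣a , d∣qr) →
         coprime-prime r-prime r∤a (d∣a , coprime-divisor
           (λ (e∣d , e∣q) → coprime-prime q-prime q∤a (∣-trans e∣d d∣a , e∣q)) d∣qr)))
  (gcd a (q ℕ.* r) ℕₚ.≟ 1) (¬? (q ∣? a) ×-dec ¬? (r ∣? a))

coprime-*-∣ : ∀ {q r} → Coprime q r → ∀ a → does (q ℕ.* r ∣? a) ≡ does (q ∣? a) ∧ does (r ∣? a)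
coprime-*-∣ {q} {r} coprime a = does-⇔
  (mk⇔ (λ qr∣a → ∣-trans (m∣m*n r) qr∣a , ∣-trans (n∣m*n q) qr∣a) (λ (q∣a , r∣a) → combine q∣a r∣a))
  (q ℕ.* r ∣? a) (q ∣? a ×-dec r ∣? a)
  where
  combine : ∀ {a} → q ∣ a → r ∣ a → q ℕ.* r ∣ a
  combine (divides k ≡.refl) r∣kq = ≡.subst (q ℕ.* r ∣_) (ℕₚ.*-comm q k)
    (*-monoʳ-∣ q (coprime-divisor (Coprimality.sym coprime) (≡.subst (r ∣_) (ℕₚ.*-comm k q) r∣kq)))

module CyclotomicValues {c ℓ} (R : CommutativeRing c ℓ) where

  open CommutativeRing R
  open RootsOfUnity R
  open import Algebra.Properties.CommutativeSemiring.Exp commutativeSemiring using (_^_; ^-congˡ)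
  open import Algebra.Properties.Ring ring using (x∙y⁻¹≈ε⇒x≈y)
  open import Relation.Binary.Reasoning.Setoid setoid

  linear : Carrier → Carrier → ℕ → Carrier
  linear ζ z a = z - ζ ^ a

  -- The counterpart of `Φ` in an arbitrary commutative ring; over ℂ the two are identified by
  -- `Φ≈Ψ`.
  Ψ : ℕ → Carrier → Carrier → Carrier
  Ψ n ζ z = foldr _*_ 1# (map (linear ζ z) (totatives n))

  Ψ-cong : ∀ n ζ z (f : ℕ → Carrier) → (∀ a → f a ≈ linear ζ z a) →
           foldr _*_ 1# (map f (totatives n)) ≈ Ψ n ζ z
  Ψ-cong n ζ z f f≈linear = on-list (totatives n)
    where
    on-list : ∀ as → foldr _*_ 1# (map f as) ≈ foldr _*_ 1# (map (linear ζ z) as)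
    on-list []       = refl
    on-list (a ∷ as) = *-cong (f≈linear a) (on-list as)

  Ψ≈∏ : ∀ n ζ z → Ψ n ζ z ≈ ∏ n (λ i → (z - ζ ^ suc i) if does (gcd (suc i) n ℕₚ.≟ 1))
  Ψ≈∏ n ζ z = trans
    (reflexive (≡.cong (λ as → foldr _*_ 1# (map (linear ζ z) (filter (λ a → gcd a n ℕₚ.≟ 1) as))) (map-upTo suc n)))
    (∏-filter (λ a → gcd a n ℕₚ.≟ 1) (linear ζ z) suc n)

  split : ∀ x b → x if not b * x if b ≈ x
  split x true  = *-identityˡ x
  split x false = *-identityʳ x

  -- Inclusion–exclusion for two conditions.
  split₂ : ∀ x b c → x if (not b ∧ not c) * (x if b * x if c) ≈ x * x if (b ∧ c)
  split₂ x true  true  = *-identityˡ _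
  split₂ x true  false = *-identityˡ _
  split₂ x false true  = trans (*-identityˡ _) (*-comm 1# x)
  split₂ x false false = *-congˡ (*-identityˡ 1#)

  -- Each exponent is either coprime to p or a multiple of p. The multiples contribute z^1 - 1, so
  -- both kinds together give the full product z^p - 1.
  Ψ-prime : ∀ {p} → Prime p → ∀ ζ → PrimitiveRoot p ζ → ∀ z →
            Ψ p ζ z * (z - 1#) ≈ z ^ p - 1#
  Ψ-prime {p} p-prime ζ order z = begin
    Ψ p ζ z * (z - 1#)
      ≈⟨ *-cong (Ψ≈∏ p ζ z) (trans (+-congʳ (sym (*-identityʳ z))) (sym
           (∏-multiples[z-ζ^a] p 1 (≡.sym (ℕₚ.*-identityˡ p)) ζ order z))) ⟩
    ∏ p (λ i → x i if does (gcd (suc i) p ℕₚ.≟ 1)) * ∏ p (λ i → x i if does (p ∣? suc i))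
      ≈⟨ ∏-* p _ _ ⟨
    ∏ p (λ i → x i if does (gcd (suc i) p ℕₚ.≟ 1) * x i if does (p ∣? suc i))
      ≈⟨ ∏-cong p (λ i _ → trans (*-congʳ (reflexive (≡.cong (x i if_) (totative-prime p-prime (suc i)))))
           (split (x i) (does (p ∣? suc i)))) ⟩
    ∏ p x
      ≈⟨ ∏[z-ζ^a]≈z^n-1 p ζ order z ⟩
    z ^ p - 1# ∎
    where
    instance
      p-nonZero : NonZero p
      p-nonZero = prime⇒nonZero p-prime

    x : ℕ → Carrier
    x i = z - ζ ^ suc i

  -- On the left the factor of an exponent a is counted once for being coprime to qr, once for q
  -- dividing a and once for r dividing a. The total is one, or two exactly when qr divides a, and
  -- those second copies form z - 1.
  Ψ-semiprime : ∀ {q r} → Prime q → Prime r → q ≢ r →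
    ∀ ζ → PrimitiveRoot (q ℕ.* r) ζ → ∀ z →
    Ψ (q ℕ.* r) ζ z * ((z ^ q - 1#) * (z ^ r - 1#)) ≈ (z ^ (q ℕ.* r) - 1#) * (z - 1#)
  Ψ-semiprime {q} {r} q-prime r-prime q≢r ζ order z = begin
    Ψ n ζ z * ((z ^ q - 1#) * (z ^ r - 1#))
      ≈⟨ *-cong (Ψ≈∏ n ζ z) (trans (*-comm _ _) (sym (*-cong
           (∏-multiples[z-ζ^a] q r (ℕₚ.*-comm q r) ζ order z)
           (∏-multiples[z-ζ^a] r q ≡.refl ζ order z)))) ⟩
    ∏ n (λ i → x i if does (gcd (suc i) n ℕₚ.≟ 1)) *
      (∏ n (λ i → x i if does (q ∣? suc i)) * ∏ n (λ i → x i if does (r ∣? suc i)))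
      ≈⟨ trans (∏-* n _ _) (*-congˡ (∏-* n _ _)) ⟨
    ∏ n (λ i → x i if does (gcd (suc i) n ℕₚ.≟ 1) *
      (x i if does (q ∣? suc i) * x i if does (r ∣? suc i)))
      ≈⟨ ∏-cong n (λ i _ → pointwise i) ⟩
    ∏ n (λ i → x i * x i if does (n ∣? suc i))
      ≈⟨ ∏-* n _ _ ⟩
    ∏ n x * ∏ n (λ i → x i if does (n ∣? suc i))
      ≈⟨ *-cong (∏[z-ζ^a]≈z^n-1 n ζ order z)
           (trans (∏-multiples[z-ζ^a] n 1 (≡.sym (ℕₚ.*-identityˡ n)) ζ order z) (+-congʳ (*-identityʳ z))) ⟩
    (z ^ n - 1#) * (z - 1#) ∎
    where
    n : ℕ
    n = q ℕ.* r

    instance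
      q-nonZero : NonZero q
      q-nonZero = prime⇒nonZero q-prime
      r-nonZero : NonZero r
      r-nonZero = prime⇒nonZero r-prime
      n-nonZero : NonZero n
      n-nonZero = ℕₚ.m*n≢0 q r

    x : ℕ → Carrier
    x i = z - ζ ^ suc i

    pointwise : ∀ i → x i if does (gcd (suc i) n ℕₚ.≟ 1) *
                        (x i if does (q ∣? suc i) * x i if does (r ∣? suc i)) ≈
                      x i * x i if does (n ∣? suc i)
    pointwise i = begin
      x i if does (gcd (suc i) n ℕₚ.≟ 1) * (x i if q∣a * x i if r∣a)
        ≡⟨ ≡.cong (λ b → x i if b * (x i if q∣a * x i if r∣a)) (totative-semiprime q-prime r-prime (suc i)) ⟩
      x i if (not q∣a ∧ not r∣a) * (x i if q∣a * x i if r∣a)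
        ≈⟨ split₂ (x i) q∣a r∣a ⟩
      x i * x i if (q∣a ∧ r∣a)
        ≡⟨ ≡.cong (λ b → x i * x i if b) (coprime-*-∣ (distinct-primes-coprime q-prime r-prime q≢r) (suc i)) ⟨
      x i * x i if does (n ∣? suc i) ∎
      where
      q∣a r∣a : Bool
      q∣a = does (q ∣? suc i)
      r∣a = does (r ∣? suc i)

  -- Ψ p = Ψ (q r) at z, cleared of denominators by means of Ψ-prime and Ψ-semiprime.
  gap : ℕ → ℕ → ℕ → Carrier → Carrier
  gap p q r z = (z ^ p - 1#) * ((z ^ q - 1#) * (z ^ r - 1#)) - (z ^ (q ℕ.* r) - 1#) * ((z - 1#) * (z - 1#))

  gap-cong : ∀ p q r {z w} → z ≈ w → gap p q r z ≈ gap p q r w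
  gap-cong p q r z≈w = +-cong
    (*-cong (power p) (*-cong (power q) (power r)))
    (-‿cong (*-cong (power (q ℕ.* r)) (*-cong (+-congʳ z≈w) (+-congʳ z≈w))))
    where
    power : ∀ n → _ ^ n - 1# ≈ _ ^ n - 1#
    power n = +-congʳ (^-congˡ n z≈w)

  -- After multiplication by the cancellable element (z - 1) (z^q - 1) (z^r - 1), the two product
  -- formulas turn the equation into the vanishing of `gap`.
  Ψ-agree : ∀ {p q r} → Prime p → Prime q → Prime r → q ≢ r →
    ∀ ζ ξ → PrimitiveRoot p ζ → PrimitiveRoot (q ℕ.* r) ξ →
    ∀ z → (∀ n .{{_ : NonZero n}} → Cancellable (z ^ n - 1#)) →
    gap p q r z ≈ 0# →
    Ψ p ζ z ≈ Ψ (q ℕ.* r) ξ z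
  Ψ-agree {p} {q} {r} p-prime q-prime r-prime q≢r ζ ξ ζ-order ξ-order z cancellable gap≈0 =
    *-cancelˡ (cancel-* (cancel-cong (+-congʳ (*-identityʳ z)) (cancellable 1))
                (cancel-* (cancellable q {{prime⇒nonZero q-prime}}) (cancellable r {{prime⇒nonZero r-prime}})))
      (begin
        d * e * Ψ p ζ z                ≈⟨ trans (*-comm _ _) (sym (*-assoc _ _ _)) ⟩
        Ψ p ζ z * d * e                ≈⟨ *-congʳ (Ψ-prime p-prime ζ ζ-order z) ⟩
        (z ^ p - 1#) * e               ≈⟨ x∙y⁻¹≈ε⇒x≈y _ _ gap≈0 ⟩
        (z ^ n - 1#) * (d * d)         ≈⟨ *-assoc _ _ _ ⟨
        (z ^ n - 1#) * d * d           ≈⟨ *-congʳ (Ψ-semiprime q-prime r-prime q≢r ξ ξ-order z) ⟨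
        Ψ n ξ z * e * d                ≈⟨ trans (*-assoc _ _ _) (trans (*-comm _ _) (*-congʳ (*-comm e d))) ⟩
        d * e * Ψ n ξ z                ∎)
    where
    n : ℕ
    n = q ℕ.* r
    d e : Carrier
    d = z - 1#
    e = (z ^ q - 1#) * (z ^ r - 1#)

open +-*-Solver using (solve; con; _:+_; _:*_; _:-_; :-_; _:=_)
open import Data.Rational.Base using (_+_)

-- ℂ as a commutative ring

module ℝₛ = Setoid ℝ-setoid

-- The ring laws of ℂ hold term by term on the representing sequences, so each reduces to an
-- identity in ℚ; estimates enter only in the congruence of multiplication.
pointwise : ∀ x y → (∀ n → seq x n ≡ seq y n) → x ≈ℝ y
pointwise x y x≡y ε 0<ε = 0 , λ n _ →
  ≡.subst (ℚ._< ε) (≡.sym (≡.cong ℚ.∣_∣ (≡.trans (≡.cong (ℚ._- seq y n) (x≡y n)) (ℚₚ.+-inverseʳ (seq y n))))) 0<ε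

≈-from-difference : ∀ x y u v → (∀ n → seq u n ℚ.- seq v n ≡ seq x n ℚ.- seq y n) →
                    x ≈ℝ y → u ≈ℝ v
≈-from-difference x y u v eq x≈y ε 0<ε = let N , h = x≈y ε 0<ε in
  N , λ n N≤n → ≡.subst (λ d → ℚ.∣ d ∣ ℚ.< ε) (≡.sym (eq n)) (h n N≤n)

+ℝ-congˡ : ∀ x {u v} → u ≈ℝ v → x +ℝ u ≈ℝ x +ℝ v
+ℝ-congˡ x {u} {v} = ≈-from-difference u v (x +ℝ u) (x +ℝ v) λ n →
  solve 3 (λ x u v → (x :+ u) :- (x :+ v) := u :- v) ≡.refl (seq x n) (seq u n) (seq v n)

+ℝ-congʳ : ∀ x {u v} → u ≈ℝ v → u +ℝ x ≈ℝ v +ℝ x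
+ℝ-congʳ x {u} {v} = ≈-from-difference u v (u +ℝ x) (v +ℝ x) λ n →
  solve 3 (λ x u v → (u :+ x) :- (v :+ x) := u :- v) ≡.refl (seq x n) (seq u n) (seq v n)

+ℝ-cong : ∀ {x y u v} → x ≈ℝ y → u ≈ℝ v → x +ℝ u ≈ℝ y +ℝ v
+ℝ-cong {x} {y} {u} {v} x≈y u≈v = ℝₛ.trans {x +ℝ u} {x +ℝ v} {y +ℝ v} (+ℝ-congˡ x {u} {v} u≈v) (+ℝ-congʳ v {x} {y} x≈y)

-ℝ-cong : ∀ {x y} → x ≈ℝ y → -ℝ x ≈ℝ -ℝ y
-ℝ-cong {x} {y} x≈y = ≈-from-difference y x (-ℝ x) (-ℝ y) (λ n →
  solve 2 (λ x y → (:- x) :- (:- y) := y :- x) ≡.refl (seq x n) (seq y n)) (ℝₛ.sym {x} {y} x≈y)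

bounded : ∀ x → Σ[ B ∈ ℚ ] 0ℚ ℚ.< B × ∃[ N ] (∀ n → N ℕ.≤ n → ℚ.∣ seq x n ∣ ℚ.≤ B)
bounded x = let N , h = cauchy x 1ℚ (ℚₚ.positive⁻¹ 1ℚ) in
  ℚ.∣ seq x N ∣ ℚ.+ 1ℚ , ℚₚ.+-mono-≤-< (ℚₚ.0≤∣p∣ (seq x N)) (ℚₚ.positive⁻¹ 1ℚ) ,
  N , λ n N≤n → begin
    ℚ.∣ seq x n ∣                                      ≡⟨ ≡.cong ℚ.∣_∣ (solve 2 (λ a b → a := b :+ (a :- b)) ≡.refl (seq x n) (seq x N)) ⟩
    ℚ.∣ seq x N ℚ.+ (seq x n ℚ.- seq x N) ∣            ≤⟨ ℚₚ.∣p+q∣≤∣p∣+∣q∣ (seq x N) (seq x n ℚ.- seq x N) ⟩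
    ℚ.∣ seq x N ∣ ℚ.+ ℚ.∣ seq x n ℚ.- seq x N ∣        ≤⟨ ℚₚ.+-monoʳ-≤ ℚ.∣ seq x N ∣ (ℚₚ.<⇒≤ (h n N N≤n ℕₚ.≤-refl)) ⟩
    ℚ.∣ seq x N ∣ ℚ.+ 1ℚ                               ∎
  where open ℚₚ.≤-Reasoning

Null : (ℕ → ℚ) → Set
Null s = ∀ ε → 0ℚ ℚ.< ε → ∃[ N ] (∀ n → N ℕ.≤ n → ℚ.∣ s n ∣ ℚ.< ε)

bounded*null : ∀ (s d : ℕ → ℚ) B → 0ℚ ℚ.< B → ∀ M → (∀ n → M ℕ.≤ n → ℚ.∣ s n ∣ ℚ.≤ B) →
               Null d → Null (λ n → s n ℚ.* d n)
bounded*null s d B 0<B M s≤B d-null ε 0<ε = M ℕ.⊔ proj₁ small , λ n ⊔≤n → begin-strict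
    ℚ.∣ s n ℚ.* d n ∣           ≡⟨ ℚₚ.∣p*q∣≡∣p∣*∣q∣ (s n) (d n) ⟩
    ℚ.∣ s n ∣ ℚ.* ℚ.∣ d n ∣     ≤⟨ ℚₚ.*-monoʳ-≤-nonNeg ℚ.∣ d n ∣ {{ℚₚ.∣-∣-nonNeg (d n)}} (s≤B n (ℕₚ.m⊔n≤o⇒m≤o M _ ⊔≤n)) ⟩
    B ℚ.* ℚ.∣ d n ∣             <⟨ ℚₚ.*-monoʳ-<-pos B (proj₂ small n (ℕₚ.m⊔n≤o⇒n≤o M _ ⊔≤n)) ⟩
    B ℚ.* (ℚ.1/ B ℚ.* ε)        ≡⟨ ℚₚ.*-assoc B (ℚ.1/ B) ε ⟨
    B ℚ.* ℚ.1/ B ℚ.* ε          ≡⟨ ≡.cong (ℚ._* ε) (ℚₚ.*-inverseʳ B) ⟩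
    1ℚ ℚ.* ε                    ≡⟨ ℚₚ.*-identityˡ ε ⟩
    ε                           ∎
  where
  open ℚₚ.≤-Reasoning
  instance
    B-positive : ℚ.Positive B
    B-positive = ℚ.positive 0<B
    B-nonZero : ℚ.NonZero B
    B-nonZero = ℚₚ.pos⇒nonZero B

  small : ∃[ N ] (∀ n → N ℕ.≤ n → ℚ.∣ d n ∣ ℚ.< ℚ.1/ B ℚ.* ε)
  small = d-null (ℚ.1/ B ℚ.* ε) (≡.subst (ℚ._< ℚ.1/ B ℚ.* ε) (ℚₚ.*-zeroʳ (ℚ.1/ B))
    (ℚₚ.*-monoʳ-<-pos (ℚ.1/ B) {{ℚₚ.1/pos⇒pos B}} 0<ε))

*ℝ-congˡ : ∀ x {u v} → u ≈ℝ v → x *ℝ u ≈ℝ x *ℝ v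
*ℝ-congˡ x {u} {v} u≈v ε 0<ε =
  let B , 0<B , M , x≤B = bounded x
      N , h = bounded*null (seq x) (λ n → seq u n ℚ.- seq v n) B 0<B M x≤B u≈v ε 0<ε
  in N , λ n N≤n → ≡.subst (λ d → ℚ.∣ d ∣ ℚ.< ε)
       (solve 3 (λ x u v → x :* (u :- v) := x :* u :- x :* v) ≡.refl (seq x n) (seq u n) (seq v n)) (h n N≤n)

*ℝ-cong : ∀ {x y u v} → x ≈ℝ y → u ≈ℝ v → x *ℝ u ≈ℝ y *ℝ v
*ℝ-cong {x} {y} {u} {v} x≈y u≈v = ℝₛ.trans {x *ℝ u} {x *ℝ v} {y *ℝ v} (*ℝ-congˡ x {u} {v} u≈v)
  (≈-from-difference (v *ℝ x) (v *ℝ y) (x *ℝ v) (y *ℝ v) (λ n →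
     solve 3 (λ x y v → x :* v :- y :* v := v :* x :- v :* y) ≡.refl (seq x n) (seq y n) (seq v n))
   (*ℝ-congˡ v {x} {y} x≈y))

pointwiseℂ : ∀ z w → (∀ n → seq (re z) n ≡ seq (re w) n) → (∀ n → seq (im z) n ≡ seq (im w) n) → z ≈ℂ w
pointwiseℂ z w re≡ im≡ = pointwise (re z) (re w) re≡ , pointwise (im z) (im w) im≡

ℂ-commutativeRing : CommutativeRing 0ℓ 0ℓ
ℂ-commutativeRing = record
  { Carrier           = ℂ
  ; _≈_               = _≈ℂ_
  ; _+_               = _+ℂ_
  ; _*_               = _*ℂ_
  ; -_                = -ℂ_
  ; 0#                = ofℝ 0ℝ
  ; 1#                = 1ℂ
  ; isCommutativeRing = record
    { isRing = record
      { +-isAbelianGroup = record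
        { isGroup = record
          { isMonoid = record
            { isSemigroup = record
              { isMagma = record
                { isEquivalence = record
                  { refl  = λ {z} → ℝₛ.refl {re z} , ℝₛ.refl {im z}
                  ; sym   = λ {z} {w} (r , i) → ℝₛ.sym {re z} {re w} r , ℝₛ.sym {im z} {im w} i
                  ; trans = λ {z} {w} {t} (r , i) (r′ , i′) →
                      ℝₛ.trans {re z} {re w} {re t} r r′ , ℝₛ.trans {im z} {im w} {im t} i i′
                  }
                ; ∙-cong = λ {z} {w} {t} {u} (r , i) (r′ , i′) →
                    +ℝ-cong {re z} {re w} {re t} {re u} r r′ , +ℝ-cong {im z} {im w} {im t} {im u} i i′
                }
              ; assoc = λ z w t →
                  pointwiseℂ ((z +ℂ w) +ℂ t) (z +ℂ (w +ℂ t))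
                    (λ n → ℚₚ.+-assoc (seq (re z) n) (seq (re w) n) (seq (re t) n))
                    (λ n → ℚₚ.+-assoc (seq (im z) n) (seq (im w) n) (seq (im t) n))
              }
            ; identity =
                (λ z → pointwiseℂ (ofℝ 0ℝ +ℂ z) z
                  (λ n → ℚₚ.+-identityˡ (seq (re z) n))
                  (λ n → ℚₚ.+-identityˡ (seq (im z) n))) ,
                (λ z → pointwiseℂ (z +ℂ ofℝ 0ℝ) z
                  (λ n → ℚₚ.+-identityʳ (seq (re z) n))
                  (λ n → ℚₚ.+-identityʳ (seq (im z) n)))
            }
          ; inverse =
              (λ z → pointwiseℂ (-ℂ z +ℂ z) (ofℝ 0ℝ)
                  (λ n → ℚₚ.+-inverseˡ (seq (re z) n))
                  (λ n → ℚₚ.+-inverseˡ (seq (im z) n))) ,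
              (λ z → pointwiseℂ (z +ℂ -ℂ z) (ofℝ 0ℝ)
                  (λ n → ℚₚ.+-inverseʳ (seq (re z) n))
                  (λ n → ℚₚ.+-inverseʳ (seq (im z) n)))
          ; ⁻¹-cong = λ {z} {w} (r , i) → -ℝ-cong {re z} {re w} r , -ℝ-cong {im z} {im w} i
          }
        ; comm = λ z w →
            pointwiseℂ (z +ℂ w) (w +ℂ z)
              (λ n → ℚₚ.+-comm (seq (re z) n) (seq (re w) n))
              (λ n → ℚₚ.+-comm (seq (im z) n) (seq (im w) n))
        }
      ; *-cong = λ {z} {w} {t} {u} (r , i) (r′ , i′) →
          +ℝ-cong {re z *ℝ re t} {re w *ℝ re u} { -ℝ (im z *ℝ im t)} { -ℝ (im w *ℝ im u)}
            (*ℝ-cong {re z} {re w} {re t} {re u} r r′)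
            (-ℝ-cong {im z *ℝ im t} {im w *ℝ im u} (*ℝ-cong {im z} {im w} {im t} {im u} i i′)) ,
          +ℝ-cong {re z *ℝ im t} {re w *ℝ im u} {im z *ℝ re t} {im w *ℝ re u}
            (*ℝ-cong {re z} {re w} {im t} {im u} r i′)
            (*ℝ-cong {im z} {im w} {re t} {re u} i r′)
      ; *-assoc = λ z w t →
          pointwiseℂ ((z *ℂ w) *ℂ t) (z *ℂ (w *ℂ t))
            (λ n → solve 6 (λ a b c d e f →
              (a :* c :- b :* d) :* e :- (a :* d :+ b :* c) :* f :=
              a :* (c :* e :- d :* f) :- b :* (c :* f :+ d :* e)) ≡.refl
            (seq (re z) n) (seq (im z) n) (seq (re w) n) (seq (im w) n) (seq (re t) n) (seq (im t) n))
            (λ n → solve 6 (λ a b c d e f →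
              (a :* c :- b :* d) :* f :+ (a :* d :+ b :* c) :* e :=
              a :* (c :* f :+ d :* e) :+ b :* (c :* e :- d :* f)) ≡.refl
            (seq (re z) n) (seq (im z) n) (seq (re w) n) (seq (im w) n) (seq (re t) n) (seq (im t) n))
      ; *-identity =
          (λ z →
            pointwiseℂ (1ℂ *ℂ z) z
              (λ n → solve 2 (λ a b → con 1ℚ :* a :- con 0ℚ :* b := a) ≡.refl (seq (re z) n) (seq (im z) n))
              (λ n → solve 2 (λ a b → con 1ℚ :* b :+ con 0ℚ :* a := b) ≡.refl (seq (re z) n) (seq (im z) n))) ,
          (λ z →
            pointwiseℂ (z *ℂ 1ℂ) z
              (λ n → solve 2 (λ a b → a :* con 1ℚ :- b :* con 0ℚ := a) ≡.refl (seq (re z) n) (seq (im z) n))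
              (λ n → solve 2 (λ a b → a :* con 0ℚ :+ b :* con 1ℚ := b) ≡.refl (seq (re z) n) (seq (im z) n)))
      ; distrib =
          (λ z w t →
            pointwiseℂ (z *ℂ (w +ℂ t)) (z *ℂ w +ℂ z *ℂ t)
              (λ n → solve 6 (λ a b c d e f →
                a :* (c :+ e) :- b :* (d :+ f) := a :* c :- b :* d :+ (a :* e :- b :* f)) ≡.refl
              (seq (re z) n) (seq (im z) n) (seq (re w) n) (seq (im w) n) (seq (re t) n) (seq (im t) n))
              (λ n → solve 6 (λ a b c d e f →
                a :* (d :+ f) :+ b :* (c :+ e) := a :* d :+ b :* c :+ (a :* f :+ b :* e)) ≡.refl
              (seq (re z) n) (seq (im z) n) (seq (re w) n) (seq (im w) n) (seq (re t) n) (seq (im t) n))) ,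
          (λ z w t →
            pointwiseℂ ((w +ℂ t) *ℂ z) (w *ℂ z +ℂ t *ℂ z)
              (λ n → solve 6 (λ a b c d e f →
                (c :+ e) :* a :- (d :+ f) :* b := c :* a :- d :* b :+ (e :* a :- f :* b)) ≡.refl
              (seq (re z) n) (seq (im z) n) (seq (re w) n) (seq (im w) n) (seq (re t) n) (seq (im t) n))
              (λ n → solve 6 (λ a b c d e f →
                (c :+ e) :* b :+ (d :+ f) :* a := c :* b :+ d :* a :+ (e :* b :+ f :* a)) ≡.refl
              (seq (re z) n) (seq (im z) n) (seq (re w) n) (seq (im w) n) (seq (re t) n) (seq (im t) n)))
      }
    ; *-comm = λ z w →
        pointwiseℂ (z *ℂ w) (w *ℂ z)
          (λ n → solve 4 (λ a b c d → a :* c :- b :* d := c :* a :- d :* b) ≡.refl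
          (seq (re z) n) (seq (im z) n) (seq (re w) n) (seq (im w) n))
          (λ n → solve 4 (λ a b c d → a :* d :+ b :* c := c :* b :+ d :* a) ≡.refl
          (seq (re z) n) (seq (im z) n) (seq (re w) n) (seq (im w) n))
    }
  }

module ℂᵣ = CommutativeRing ℂ-commutativeRing
open RootsOfUnity ℂ-commutativeRing using (Cancellable; PrimitiveRoot)
open CyclotomicValues ℂ-commutativeRing using (Ψ; Ψ-cong; linear; Ψ-agree)
  renaming (gap to gapℂ; gap-cong to gapℂ-cong)
open CyclotomicValues ℚₚ.+-*-commutativeRing using () renaming (gap to gapℚ)
open import Algebra.Properties.CommutativeSemiring.Exp (CommutativeRing.commutativeSemiring ℚₚ.+-*-commutativeRing)
  using (^-homo-*) renaming (_^_ to _^ℚ_)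

-- Inequalities in ℚ

0≤+ : ∀ {p q} → 0ℚ ℚ.≤ p → 0ℚ ℚ.≤ q → 0ℚ ℚ.≤ p ℚ.+ q
0≤+ = ℚₚ.+-mono-≤

0≤* : ∀ {p q} → 0ℚ ℚ.≤ p → 0ℚ ℚ.≤ q → 0ℚ ℚ.≤ p ℚ.* q
0≤* {p} {q} 0≤p 0≤q = ℚₚ.nonNegative⁻¹ (p ℚ.* q)
  {{ℚₚ.nonNeg*nonNeg⇒nonNeg p {{ℚ.nonNegative 0≤p}} q {{ℚ.nonNegative 0≤q}}}}

*-mono-≤ : ∀ {p q r s} → 0ℚ ℚ.≤ p → 0ℚ ℚ.≤ s → p ℚ.≤ q → r ℚ.≤ s → p ℚ.* r ℚ.≤ q ℚ.* s
*-mono-≤ {p} {q} {r} {s} 0≤p 0≤s p≤q r≤s = ℚₚ.≤-trans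
  (ℚₚ.*-monoˡ-≤-nonNeg p {{ℚ.nonNegative 0≤p}} r≤s)
  (ℚₚ.*-monoʳ-≤-nonNeg s {{ℚ.nonNegative 0≤s}} p≤q)

p≤q⇒0≤q-p : ∀ {p q} → p ℚ.≤ q → 0ℚ ℚ.≤ q ℚ.- p
p≤q⇒0≤q-p {p} {q} p≤q = ≡.subst (ℚ._≤ q ℚ.- p) (ℚₚ.+-inverseʳ p) (ℚₚ.+-monoˡ-≤ (ℚ.- p) p≤q)

0≤q-p⇒p≤q : ∀ {p q} → 0ℚ ℚ.≤ q ℚ.- p → p ℚ.≤ q
0≤q-p⇒p≤q {p} {q} 0≤q-p = ≡.subst₂ ℚ._≤_ (ℚₚ.+-identityʳ p)
  (solve 2 (λ p q → p :+ (q :- p) := q) ≡.refl p q) (ℚₚ.+-monoʳ-≤ p 0≤q-p)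

p≤∣p∣ : ∀ p → p ℚ.≤ ℚ.∣ p ∣
p≤∣p∣ p with ℚₚ.≤-total 0ℚ p
... | inj₁ 0≤p = ℚₚ.≤-reflexive (≡.sym (ℚₚ.0≤p⇒∣p∣≡p 0≤p))
... | inj₂ p≤0 = ℚₚ.≤-trans p≤0 (ℚₚ.0≤∣p∣ p)

∣p∣²≡p² : ∀ p → ℚ.∣ p ∣ ℚ.* ℚ.∣ p ∣ ≡ p ℚ.* p
∣p∣²≡p² p with ℚₚ.∣p∣≡p∨∣p∣≡-p p
... | inj₁ eq = ≡.cong₂ ℚ._*_ eq eq
... | inj₂ eq = ≡.trans (≡.cong₂ ℚ._*_ eq eq) (solve 1 (λ p → (:- p) :* (:- p) := p :* p) ≡.refl p)

∣p-q∣≡∣q-p∣ : ∀ p q → ℚ.∣ p ℚ.- q ∣ ≡ ℚ.∣ q ℚ.- p ∣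
∣p-q∣≡∣q-p∣ p q = ≡.trans (≡.sym (ℚₚ.∣-p∣≡∣p∣ (p ℚ.- q)))
  (≡.cong ℚ.∣_∣ (solve 2 (λ p q → :- (p :- q) := q :- p) ≡.refl p q))

0≤p² : ∀ p → 0ℚ ℚ.≤ p ℚ.* p
0≤p² p = ≡.subst (0ℚ ℚ.≤_) (∣p∣²≡p² p) (0≤* (ℚₚ.0≤∣p∣ p) (ℚₚ.0≤∣p∣ p))

-- Cancellation in ℂ

Null-cong : ∀ {s t : ℕ → ℚ} → (∀ n → s n ≡ t n) → Null s → Null t
Null-cong s≡t s-null ε 0<ε = let N , h = s-null ε 0<ε in
  N , λ n N≤n → ≡.subst (λ p → ℚ.∣ p ∣ ℚ.< ε) (s≡t n) (h n N≤n)

Null-cancel : ∀ (m s : ℕ → ℚ) δ → 0ℚ ℚ.< δ → ∀ N → (∀ n → N ℕ.≤ n → δ ℚ.≤ ℚ.∣ m n ∣) →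
              Null (λ n → m n ℚ.* s n) → Null s
Null-cancel m s δ 0<δ N δ≤m ms-null ε 0<ε =
  N ℕ.⊔ proj₁ small , λ n ⊔≤n → ℚₚ.*-cancelˡ-<-nonNeg δ {{ℚₚ.pos⇒nonNeg δ}} (begin-strict
    δ ℚ.* ℚ.∣ s n ∣           ≤⟨ ℚₚ.*-monoʳ-≤-nonNeg ℚ.∣ s n ∣ {{ℚₚ.∣-∣-nonNeg (s n)}} (δ≤m n (ℕₚ.m⊔n≤o⇒m≤o N _ ⊔≤n)) ⟩
    ℚ.∣ m n ∣ ℚ.* ℚ.∣ s n ∣   ≡⟨ ℚₚ.∣p*q∣≡∣p∣*∣q∣ (m n) (s n) ⟨
    ℚ.∣ m n ℚ.* s n ∣         <⟨ proj₂ small n (ℕₚ.m⊔n≤o⇒n≤o N _ ⊔≤n) ⟩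
    δ ℚ.* ε                   ∎)
  where
  open ℚₚ.≤-Reasoning
  instance
    δ-positive : ℚ.Positive δ
    δ-positive = ℚ.positive 0<δ

  small : ∃[ M ] (∀ n → M ℕ.≤ n → ℚ.∣ m n ℚ.* s n ∣ ℚ.< δ ℚ.* ε)
  small = ms-null (δ ℚ.* ε) (≡.subst (ℚ._< δ ℚ.* ε) (ℚₚ.*-zeroʳ δ) (ℚₚ.*-monoʳ-<-pos δ 0<ε))

BoundedBelow : (ℕ → ℚ) → Set
BoundedBelow s = Σ[ δ ∈ ℚ ] 0ℚ ℚ.< δ × ∃[ N ] (∀ n → N ℕ.≤ n → δ ℚ.≤ s n)

BoundedBelow-mono : ∀ {s t : ℕ → ℚ} → (∀ n → s n ℚ.≤ t n) → BoundedBelow s → BoundedBelow t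
BoundedBelow-mono s≤t (δ , 0<δ , N , δ≤s) = δ , 0<δ , N , λ n N≤n → ℚₚ.≤-trans (δ≤s n N≤n) (s≤t n)

-- Squares are bounded because the squared modulus in `#⇒cancellable` is a sum of two of them:
-- apartness in one coordinate then bounds the whole sum.
#⇒distance² : ∀ x y → x #ℝ y →
  BoundedBelow (λ n → (seq x n ℚ.- seq y n) ℚ.* (seq x n ℚ.- seq y n))
#⇒distance² x y x#y = let δ , 0<δ , N , δ≤ = distance x#y in
  δ ℚ.* δ ,
  ℚₚ.positive⁻¹ (δ ℚ.* δ) {{ℚₚ.pos*pos⇒pos δ {{ℚ.positive 0<δ}} δ {{ℚ.positive 0<δ}}}} ,
  N , λ n N≤n → ≡.subst (δ ℚ.* δ ℚ.≤_) (∣p∣²≡p² (seq x n ℚ.- seq y n))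
    (*-mono-≤ (ℚₚ.<⇒≤ 0<δ) (ℚₚ.0≤∣p∣ (seq x n ℚ.- seq y n)) (δ≤ n N≤n) (δ≤ n N≤n))
  where
  gap≤ : ∀ {p q δ} → p ℚ.+ δ ℚ.< q → δ ℚ.≤ ℚ.∣ q ℚ.- p ∣
  gap≤ {p} {q} {δ} p+δ<q = begin
    δ                   ≡⟨ solve 2 (λ p δ → δ := p :+ δ :- p) ≡.refl p δ ⟩
    p ℚ.+ δ ℚ.- p       ≤⟨ ℚₚ.+-monoˡ-≤ (ℚ.- p) (ℚₚ.<⇒≤ p+δ<q) ⟩
    q ℚ.- p             ≤⟨ p≤∣p∣ (q ℚ.- p) ⟩
    ℚ.∣ q ℚ.- p ∣       ∎
    where open ℚₚ.≤-Reasoning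

  distance : x #ℝ y → BoundedBelow (λ n → ℚ.∣ seq x n ℚ.- seq y n ∣)
  distance (inj₁ (δ , 0<δ , N , h)) = δ , 0<δ , N , λ n N≤n →
    ≡.subst (δ ℚ.≤_) (∣p-q∣≡∣q-p∣ (seq y n) (seq x n)) (gap≤ (h n N≤n))
  distance (inj₂ (δ , 0<δ , N , h)) = δ , 0<δ , N , λ n N≤n → gap≤ (h n N≤n)

-- Multiplication by the conjugate replaces z - w by its squared modulus, a real factor that is
-- eventually bounded away from 0 and can be divided out of each coordinate of b.
#⇒cancellable : ∀ z w → z #ℂ w → Cancellable (z +ℂ -ℂ w)
#⇒cancellable z w z#w b cb≈0 =
  cancel-norm (λ n → seq (re b) n) (λ n → solve 4 norm-re ≡.refl (c n) (d n) (seq (re b) n) (seq (im b) n)) (proj₁ norm*b≈0) ,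
  cancel-norm (λ n → seq (im b) n) (λ n → solve 4 norm-im ≡.refl (c n) (d n) (seq (re b) n) (seq (im b) n)) (proj₂ norm*b≈0)
  where
  c d : ℕ → ℚ
  c n = seq (re z) n ℚ.- seq (re w) n
  d n = seq (im z) n ℚ.- seq (im w) n

  conj : ℂ
  conj = re (z +ℂ -ℂ w) +i (-ℝ im (z +ℂ -ℂ w))

  norm*b≈0 : conj *ℂ ((z +ℂ -ℂ w) *ℂ b) ≈ℂ ofℝ 0ℝ
  norm*b≈0 = ℂᵣ.trans {conj *ℂ ((z +ℂ -ℂ w) *ℂ b)} {conj *ℂ ofℝ 0ℝ} {ofℝ 0ℝ}
    (ℂᵣ.*-congˡ {conj} {(z +ℂ -ℂ w) *ℂ b} {ofℝ 0ℝ} cb≈0) (ℂᵣ.zeroʳ conj)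

  norm-re norm-im : ∀ c d s t → _
  norm-re = λ c d s t →
    c :* (c :* s :- d :* t) :- (:- d) :* (c :* t :+ d :* s) :- con 0ℚ := (c :* c :+ d :* d) :* (s :- con 0ℚ)
  norm-im = λ c d s t →
    c :* (c :* t :+ d :* s) :+ (:- d) :* (c :* s :- d :* t) :- con 0ℚ := (c :* c :+ d :* d) :* (t :- con 0ℚ)

  norm-bounded : BoundedBelow (λ n → ℚ.∣ c n ℚ.* c n ℚ.+ d n ℚ.* d n ∣)
  norm-bounded = BoundedBelow-mono (λ n → p≤∣p∣ _) (from-# z#w)
    where
    from-# : z #ℂ w → BoundedBelow (λ n → c n ℚ.* c n ℚ.+ d n ℚ.* d n)
    from-# (inj₁ re#) = BoundedBelow-mono
      (λ n → ≡.subst (ℚ._≤ c n ℚ.* c n ℚ.+ d n ℚ.* d n) (ℚₚ.+-identityʳ (c n ℚ.* c n)) (ℚₚ.+-monoʳ-≤ (c n ℚ.* c n) (0≤p² (d n))))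
      (#⇒distance² (re z) (re w) re#)
    from-# (inj₂ im#) = BoundedBelow-mono
      (λ n → ≡.subst (ℚ._≤ c n ℚ.* c n ℚ.+ d n ℚ.* d n) (ℚₚ.+-identityˡ (d n ℚ.* d n)) (ℚₚ.+-monoˡ-≤ (d n ℚ.* d n) (0≤p² (c n))))
      (#⇒distance² (im z) (im w) im#)

  cancel-norm : ∀ (s : ℕ → ℚ) {t : ℕ → ℚ} →
    (∀ n → t n ≡ (c n ℚ.* c n ℚ.+ d n ℚ.* d n) ℚ.* (s n ℚ.- 0ℚ)) → Null t → Null (λ n → s n ℚ.- 0ℚ)
  cancel-norm s t≡ t-null = let δ , 0<δ , N , δ≤ = norm-bounded in
    Null-cancel (λ n → c n ℚ.* c n ℚ.+ d n ℚ.* d n) (λ n → s n ℚ.- 0ℚ) δ 0<δ N δ≤ (Null-cong t≡ t-null)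

primitive⇒ : ∀ {n ζ} → IsPrimitiveRoot n ζ → PrimitiveRoot n ζ
primitive⇒ {n} {ζ} (ζ^n≈1 , ζ^k#1) = ζ^n≈1 , λ k 1≤k k<n → #⇒cancellable (ζ ^ℂ k) 1ℂ (ζ^k#1 k 1≤k k<n)

-- Evaluation at real points

-- Termwise equality is finer than `_≈ℂ_`; it lets signs and inequalities proved in ℚ be read off
-- every term of a complex value at a real point.
Represents : ℂ → (ℕ → ℚ) → Set
Represents z s = ∀ n → seq (re z) n ≡ s n × seq (im z) n ≡ 0ℚ

represents-1 : Represents 1ℂ (λ _ → 1ℚ)
represents-1 n = ≡.refl , ≡.refl

represents-- : ∀ z w {s t} → Represents z s → Represents w t → Represents (z +ℂ -ℂ w) (λ n → s n ℚ.- t n)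
represents-- z w z~s w~t n =
  ≡.cong₂ ℚ._-_ (proj₁ (z~s n)) (proj₁ (w~t n)) , ≡.cong₂ ℚ._-_ (proj₂ (z~s n)) (proj₂ (w~t n))

represents-* : ∀ z w {s t} → Represents z s → Represents w t → Represents (z *ℂ w) (λ n → s n ℚ.* t n)
represents-* z w z~s w~t n = real-product (z~s n) (w~t n)
  where
  real-product : ∀ {a b c d s t} → a ≡ s × b ≡ 0ℚ → c ≡ t × d ≡ 0ℚ →
                 a ℚ.* c ℚ.- b ℚ.* d ≡ s ℚ.* t × a ℚ.* d ℚ.+ b ℚ.* c ≡ 0ℚ
  real-product {a} {c = c} (≡.refl , ≡.refl) (≡.refl , ≡.refl) =
    solve 2 (λ a c → a :* c :- con 0ℚ :* con 0ℚ := a :* c) ≡.refl a c ,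
    solve 2 (λ a c → a :* con 0ℚ :+ con 0ℚ :* c := con 0ℚ) ≡.refl a c

represents-^ : ∀ z {s} → Represents z s → ∀ k → Represents (z ^ℂ k) (λ n → s n ^ℚ k)
represents-^ z z~s zero    = represents-1
represents-^ z z~s (suc k) = represents-* z (z ^ℂ k) z~s (represents-^ z z~s k)

represents-^-1 : ∀ x k → Represents (ofℝ x ^ℂ k +ℂ -ℂ 1ℂ) (λ n → seq x n ^ℚ k ℚ.- 1ℚ)
represents-^-1 x k = represents-- (ofℝ x ^ℂ k) 1ℂ (represents-^ (ofℝ x) (λ _ → ≡.refl , ≡.refl) k) represents-1

represents-gap : ∀ p q r x → Represents (gapℂ p q r (ofℝ x)) (λ n → gapℚ p q r (seq x n))
represents-gap p q r x =
  represents-- (P p *ℂ (P q *ℂ P r)) (P (q ℕ.* r) *ℂ (D *ℂ D))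
    (represents-* (P p) (P q *ℂ P r) (represents-^-1 x p)
      (represents-* (P q) (P r) (represents-^-1 x q) (represents-^-1 x r)))
    (represents-* (P (q ℕ.* r)) (D *ℂ D) (represents-^-1 x (q ℕ.* r))
      (represents-* D D D~x-1 D~x-1))
  where
  P : ℕ → ℂ
  P k = ofℝ x ^ℂ k +ℂ -ℂ 1ℂ

  D : ℂ
  D = ofℝ x +ℂ -ℂ 1ℂ

  D~x-1 : Represents D (λ n → seq x n ℚ.- 1ℚ)
  D~x-1 = represents-- (ofℝ x) 1ℂ (λ _ → ≡.refl , ≡.refl) represents-1

-- The Archimedean property

ι : ℕ → ℚ
ι n = mkℚ (ℤ.+ n) 0 (Coprimality.sym (Coprimality.1-coprimeTo n))

ι-suc : ∀ n → ι (suc n) ≡ 1ℚ ℚ.+ ι n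
ι-suc n = ℚₚ.toℚᵘ-injective (ℚᵘₚ.≃-trans
  (ℚᵘ.*≡* (≡.cong (ℤ._* 1ℤ) (≡.sym (≡.cong (λ k → 1ℤ ℤ.+ k) (ℤₚ.*-identityʳ (ℤ.+ n))))))
  (ℚᵘₚ.≃-sym (ℚₚ.toℚᵘ-homo-+ 1ℚ (ι n))))

archimedean : ∀ p → ∃[ n ] p ℚ.< ι n
-- The denominator is at least 1, so any integer above the absolute value of the numerator exceeds
-- p.
archimedean p@(mkℚ i d-1 _) = suc ℤ.∣ i ∣ , ℚ.*<* (begin-strict
  i ℤ.* 1ℤ                          ≡⟨ ℤₚ.*-identityʳ i ⟩
  i                                 ≤⟨ i≤∣i∣ i ⟩
  ℤ.+ ℤ.∣ i ∣                       <⟨ ℤ.+<+ (ℕₚ.n<1+n ℤ.∣ i ∣) ⟩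
  ℤ.+ suc ℤ.∣ i ∣                   ≤⟨ ℤ.+≤+ (ℕₚ.m≤m*n (suc ℤ.∣ i ∣) (suc d-1)) ⟩
  ℤ.+ (suc ℤ.∣ i ∣ ℕ.* suc d-1)     ≡⟨ ℤₚ.pos-* (suc ℤ.∣ i ∣) (suc d-1) ⟩
  ℤ.+ suc ℤ.∣ i ∣ ℤ.* ℤ.+ suc d-1   ∎)
  where
  open ℤₚ.≤-Reasoning
  i≤∣i∣ : ∀ i → i ℤ.≤ ℤ.+ ℤ.∣ i ∣
  i≤∣i∣ (ℤ.+ n)      = ℤₚ.≤-refl
  i≤∣i∣ ℤ.-[1+ n ]   = ℤ.-≤+

archimedean-* : ∀ p {ε} → 0ℚ ℚ.< ε → ∃[ n ] p ℚ.< ι n ℚ.* ε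
archimedean-* p {ε} 0<ε = let n , p/ε<n = archimedean (p ℚ.* ℚ.1/ ε) in
  n , ≡.subst (ℚ._< ι n ℚ.* ε)
        (≡.trans (ℚₚ.*-assoc p (ℚ.1/ ε) ε) (≡.trans (≡.cong (p ℚ.*_) (ℚₚ.*-inverseˡ ε)) (ℚₚ.*-identityʳ p)))
        (ℚₚ.*-monoˡ-<-pos ε p/ε<n)
  where
  instance
    ε-positive : ℚ.Positive ε
    ε-positive = ℚ.positive 0<ε
    ε-nonZero : ℚ.NonZero ε
    ε-nonZero = ℚₚ.pos⇒nonZero ε

0≤ι : ∀ n → 0ℚ ℚ.≤ ι n
0≤ι n = ℚₚ.nonNegative⁻¹ (ι n)

ι-mono : ∀ {m n} → m ℕ.≤ n → ι m ℚ.≤ ι n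
ι-mono {m} {n} m≤n = ℚ.*≤* (ℤₚ.*-monoʳ-≤-nonNeg 1ℤ (ℤ.+≤+ m≤n))

-- Bisection

module Bisection (f : ℚ → ℚ) where

  record Bracket : Set where
    field
      lo hi  : ℚ
      lo≤hi  : lo ℚ.≤ hi
      0≤f-lo : 0ℚ ℚ.≤ f lo
      f-hi≤0 : f hi ℚ.≤ 0ℚ

    width : ℚ
    width = hi ℚ.- lo

  open Bracket

  record Halves (b c : Bracket) : Set where
    field
      lo-mono : lo b ℚ.≤ lo c
      hi-anti : hi c ℚ.≤ hi b
      halved  : width c ℚ.+ width c ≡ width b

  open Halves

  -- The midpoint and its value are rational, so the sign test that picks the half is decidable and
  -- the bisection constructive.
  halve : ∀ b → Σ[ c ∈ Bracket ] Halves b c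
  halve b = choose (ℚₚ.≤-total 0ℚ (f mid))
    where
    mid : ℚ
    mid = ½ ℚ.* (lo b ℚ.+ hi b)

    lo≤mid : lo b ℚ.≤ mid
    lo≤mid = 0≤q-p⇒p≤q (≡.subst (0ℚ ℚ.≤_)
      (solve 2 (λ l h → con ½ :* (h :- l) := con ½ :* (l :+ h) :- l) ≡.refl (lo b) (hi b))
      (0≤* (ℚₚ.nonNegative⁻¹ ½) (p≤q⇒0≤q-p (lo≤hi b))))

    mid≤hi : mid ℚ.≤ hi b
    mid≤hi = 0≤q-p⇒p≤q (≡.subst (0ℚ ℚ.≤_)
      (solve 2 (λ l h → con ½ :* (h :- l) := h :- con ½ :* (l :+ h)) ≡.refl (lo b) (hi b))
      (0≤* (ℚₚ.nonNegative⁻¹ ½) (p≤q⇒0≤q-p (lo≤hi b))))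

    choose : 0ℚ ℚ.≤ f mid ⊎ f mid ℚ.≤ 0ℚ → Σ[ c ∈ Bracket ] Halves b c
    choose (inj₁ 0≤f-mid) =
      record { lo = mid ; hi = hi b ; lo≤hi = mid≤hi ; 0≤f-lo = 0≤f-mid ; f-hi≤0 = f-hi≤0 b } ,
      record { lo-mono = lo≤mid ; hi-anti = ℚₚ.≤-refl
             ; halved = solve 2 (λ l h → (h :- con ½ :* (l :+ h)) :+ (h :- con ½ :* (l :+ h)) := h :- l) ≡.refl (lo b) (hi b) }
    choose (inj₂ f-mid≤0) =
      record { lo = lo b ; hi = mid ; lo≤hi = lo≤mid ; 0≤f-lo = 0≤f-lo b ; f-hi≤0 = f-mid≤0 } ,
      record { lo-mono = ℚₚ.≤-refl ; hi-anti = mid≤hi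
             ; halved = solve 2 (λ l h → (con ½ :* (l :+ h) :- l) :+ (con ½ :* (l :+ h) :- l) := h :- l) ≡.refl (lo b) (hi b) }

  module Iterate (b₀ : Bracket) where

    bracket : ℕ → Bracket
    bracket zero    = b₀
    bracket (suc n) = proj₁ (halve (bracket n))

    halves : ∀ n → Halves (bracket n) (bracket (suc n))
    halves n = proj₂ (halve (bracket n))

    nested : ∀ m n → lo (bracket m) ℚ.≤ lo (bracket (n ℕ.+ m)) × hi (bracket (n ℕ.+ m)) ℚ.≤ hi (bracket m)
    nested m zero    = ℚₚ.≤-refl , ℚₚ.≤-refl
    nested m (suc n) = let l , h = nested m n in
      ℚₚ.≤-trans l (lo-mono (halves (n ℕ.+ m))) , ℚₚ.≤-trans (hi-anti (halves (n ℕ.+ m))) h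

    nested-≤ : ∀ {m n} → m ℕ.≤ n → lo (bracket m) ℚ.≤ lo (bracket n) × hi (bracket n) ℚ.≤ hi (bracket m)
    nested-≤ {m} {n} m≤n = ≡.subst
      (λ k → lo (bracket m) ℚ.≤ lo (bracket k) × hi (bracket k) ℚ.≤ hi (bracket m))
      (ℕₚ.m∸n+n≡m m≤n) (nested m (n ℕ.∸ m))

    0≤width : ∀ n → 0ℚ ℚ.≤ width (bracket n)
    0≤width n = p≤q⇒0≤q-p (lo≤hi (bracket n))

    -- Weaker than the exact width b₀ / 2ⁿ, but enough to make the widths tend to 0.
    n*width≤ : ∀ n → ι (suc n) ℚ.* width (bracket n) ℚ.≤ width b₀
    n*width≤ zero    = ℚₚ.≤-reflexive (ℚₚ.*-identityˡ (width b₀))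
    n*width≤ (suc n) = begin
      ι (suc (suc n)) ℚ.* w              ≡⟨ ≡.cong (ℚ._* w) (ι-suc (suc n)) ⟩
      (1ℚ ℚ.+ ι (suc n)) ℚ.* w           ≤⟨ ℚₚ.*-monoʳ-≤-nonNeg w {{ℚ.nonNegative (0≤width (suc n))}}
                                              (ℚₚ.+-monoˡ-≤ (ι (suc n)) (ι-mono {1} {suc n} (ℕ.s≤s ℕ.z≤n))) ⟩
      (ι (suc n) ℚ.+ ι (suc n)) ℚ.* w    ≡⟨ solve 2 (λ k w → (k :+ k) :* w := k :* (w :+ w)) ≡.refl (ι (suc n)) w ⟩
      ι (suc n) ℚ.* (w ℚ.+ w)            ≡⟨ ≡.cong (ι (suc n) ℚ.*_) (halved (halves n)) ⟩
      ι (suc n) ℚ.* width (bracket n)    ≤⟨ n*width≤ n ⟩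
      width b₀                           ∎
      where
      open ℚₚ.≤-Reasoning
      w : ℚ
      w = width (bracket (suc n))

    width-small : ∀ ε → 0ℚ ℚ.< ε → ∃[ N ] width (bracket N) ℚ.< ε
    width-small ε 0<ε = let N , W<Nε = archimedean-* (width b₀) 0<ε in
      N , ℚₚ.*-cancelˡ-<-nonNeg (ι (suc N)) {{ℚ.nonNegative (0≤ι (suc N))}} (begin-strict
        ι (suc N) ℚ.* width (bracket N)   ≤⟨ n*width≤ N ⟩
        width b₀                          <⟨ W<Nε ⟩
        ι N ℚ.* ε                         ≤⟨ ℚₚ.*-monoʳ-≤-nonNeg ε {{ℚ.nonNegative (ℚₚ.<⇒≤ 0<ε)}} (ι-mono (ℕₚ.n≤1+n N)) ⟩
        ι (suc N) ℚ.* ε                   ∎)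
      where open ℚₚ.≤-Reasoning

    within : ∀ {l h ε p q} → h ℚ.- l ℚ.< ε → l ℚ.≤ p → p ℚ.≤ h → l ℚ.≤ q → q ℚ.≤ h → ℚ.∣ p ℚ.- q ∣ ℚ.< ε
    within {l} {h} {ε} {p} {q} h-l<ε l≤p p≤h l≤q q≤h with ℚₚ.∣p∣≡p∨∣p∣≡-p (p ℚ.- q)
    ... | inj₁ eq = ℚₚ.≤-<-trans (ℚₚ.≤-trans (ℚₚ.≤-reflexive eq) (ℚₚ.+-mono-≤ p≤h (ℚₚ.neg-antimono-≤ l≤q))) h-l<ε
    ... | inj₂ eq = ℚₚ.≤-<-trans (ℚₚ.≤-trans
      (ℚₚ.≤-reflexive (≡.trans eq (solve 2 (λ p q → :- (p :- q) := q :- p) ≡.refl p q)))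
      (ℚₚ.+-mono-≤ q≤h (ℚₚ.neg-antimono-≤ l≤p))) h-l<ε

    lo∈ : ∀ {m n} → m ℕ.≤ n → lo (bracket m) ℚ.≤ lo (bracket n) × lo (bracket n) ℚ.≤ hi (bracket m)
    lo∈ {m} {n} m≤n = let l , h = nested-≤ m≤n in l , ℚₚ.≤-trans (lo≤hi (bracket n)) h

    hi∈ : ∀ {m n} → m ℕ.≤ n → lo (bracket m) ℚ.≤ hi (bracket n) × hi (bracket n) ℚ.≤ hi (bracket m)
    hi∈ {m} {n} m≤n = let l , h = nested-≤ m≤n in ℚₚ.≤-trans l (lo≤hi (bracket n)) , h

    lower upper : ℝ
    lower = mkℝ (λ n → lo (bracket n)) λ ε 0<ε → let N , small = width-small ε 0<ε in
      N , λ m n N≤m N≤n → within small (proj₁ (lo∈ N≤m)) (proj₂ (lo∈ N≤m)) (proj₁ (lo∈ N≤n)) (proj₂ (lo∈ N≤n))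
    upper = mkℝ (λ n → hi (bracket n)) λ ε 0<ε → let N , small = width-small ε 0<ε in
      N , λ m n N≤m N≤n → within small (proj₁ (hi∈ N≤m)) (proj₂ (hi∈ N≤m)) (proj₁ (hi∈ N≤n)) (proj₂ (hi∈ N≤n))

    lower≈upper : lower ≈ℝ upper
    lower≈upper ε 0<ε = let N , small = width-small ε 0<ε in
      N , λ n N≤n → within small (proj₁ (lo∈ N≤n)) (proj₂ (lo∈ N≤n)) (proj₁ (hi∈ N≤n)) (proj₂ (hi∈ N≤n))

    -- Since f is nonnegative at the lower and nonpositive at the upper endpoint, its value at the
    -- lower one is at most the difference of the two. Continuity of f is present only as the
    -- hypothesis.
    f-lower-null : Null (λ n → f (seq lower n) ℚ.- f (seq upper n)) → Null (λ n → f (seq lower n) ℚ.- 0ℚ)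
    f-lower-null f-null ε 0<ε = let N , h = f-null ε 0<ε in
      N , λ n N≤n → let b = bracket n in ℚₚ.≤-<-trans (begin
        ℚ.∣ f (lo b) ℚ.- 0ℚ ∣           ≡⟨ ≡.cong ℚ.∣_∣ (ℚₚ.+-identityʳ (f (lo b))) ⟩
        ℚ.∣ f (lo b) ∣                  ≡⟨ ℚₚ.0≤p⇒∣p∣≡p (0≤f-lo b) ⟩
        f (lo b)                        ≡⟨ ℚₚ.+-identityʳ (f (lo b)) ⟨
        f (lo b) ℚ.- 0ℚ                 ≤⟨ ℚₚ.+-monoʳ-≤ (f (lo b)) (ℚₚ.neg-antimono-≤ (f-hi≤0 b)) ⟩
        f (lo b) ℚ.- f (hi b)           ≤⟨ p≤∣p∣ (f (lo b) ℚ.- f (hi b)) ⟩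
        ℚ.∣ f (lo b) ℚ.- f (hi b) ∣     ∎) (h n N≤n)
      where open ℚₚ.≤-Reasoning

-- The continuity that bisection calls for is the congruence `gapℂ-cong`: the endpoint sequences
-- define equal reals, so the gaps at them differ by a null sequence.
gap-root : ∀ p q r a b → a ℚ.≤ b → 0ℚ ℚ.≤ gapℚ p q r a → gapℚ p q r b ℚ.≤ 0ℚ →
           Σ[ x ∈ ℝ ] (∀ n → a ℚ.≤ seq x n) × gapℂ p q r (ofℝ x) ≈ℂ ofℝ 0ℝ
gap-root p q r a b a≤b 0≤f-a f-b≤0 = lower , (λ n → proj₁ (lo∈ (ℕ.z≤n {n}))) ,
  Null-cong (λ n → ≡.cong (ℚ._- 0ℚ) (≡.sym (proj₁ (represents-gap p q r lower n))))
    (f-lower-null (Null-cong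
      (λ n → ≡.cong₂ ℚ._-_ (proj₁ (represents-gap p q r lower n)) (proj₁ (represents-gap p q r upper n)))
      (proj₁ gap≈))) ,
  pointwise (im (gapℂ p q r (ofℝ lower))) 0ℝ (λ n → proj₂ (represents-gap p q r lower n))
  where
  open Bisection (gapℚ p q r)

  initial : Bracket
  initial = record { lo = a ; hi = b ; lo≤hi = a≤b ; 0≤f-lo = 0≤f-a ; f-hi≤0 = f-b≤0 }

  open Iterate initial

  gap≈ : gapℂ p q r (ofℝ lower) ≈ℂ gapℂ p q r (ofℝ upper)
  gap≈ = gapℂ-cong p q r {ofℝ lower} {ofℝ upper} (lower≈upper , ℝₛ.refl {0ℝ})

-- Signs of the gap

2ℚ 3ℚ : ℚ
2ℚ = 1ℚ + 1ℚ
3ℚ = 2ℚ + 1ℚ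

-- Bernoulli's inequality with excess 1/2. The bound is uniform in x, so thresholds derived from it
-- depend on η alone.
bernoulli : ∀ {x} → 1ℚ + ½ ℚ.≤ x → ∀ n → 1ℚ + ½ ℚ.* ι n ℚ.≤ x ^ℚ n
bernoulli 3/2≤x zero    = ℚₚ.≤-refl
bernoulli {x} 3/2≤x (suc n) = begin
  1ℚ + ½ ℚ.* ι (suc n)                             ≡⟨ ≡.cong (λ k → 1ℚ + ½ ℚ.* k) (ι-suc n) ⟩
  1ℚ + ½ ℚ.* (1ℚ + ι n)                            ≤⟨ 0≤q-p⇒p≤q (≡.subst (0ℚ ℚ.≤_)
    (solve 1 (λ k → con ½ :* (con ½ :* k) := (con 1ℚ :+ con ½) :* (con 1ℚ :+ con ½ :* k) :- (con 1ℚ :+ con ½ :* (con 1ℚ :+ k))) ≡.refl (ι n))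
    (0≤* (ℚₚ.nonNegative⁻¹ ½) (0≤* (ℚₚ.nonNegative⁻¹ ½) (0≤ι n)))) ⟩
  (1ℚ + ½) ℚ.* (1ℚ + ½ ℚ.* ι n)                    ≤⟨ *-mono-≤ (ℚₚ.nonNegative⁻¹ (1ℚ + ½))
    (ℚₚ.≤-trans (0≤+ (ℚₚ.nonNegative⁻¹ 1ℚ) (0≤* (ℚₚ.nonNegative⁻¹ ½) (0≤ι n))) (bernoulli 3/2≤x n))
    3/2≤x (bernoulli 3/2≤x n) ⟩
  x ℚ.* x ^ℚ n                                     ∎
  where open ℚₚ.≤-Reasoning

1≤x^n : ∀ {x} → 1ℚ + ½ ℚ.≤ x → ∀ n → 1ℚ ℚ.≤ x ^ℚ n
1≤x^n 3/2≤x n = ℚₚ.≤-trans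
  (ℚₚ.≤-trans (ℚₚ.≤-reflexive (≡.sym (ℚₚ.+-identityʳ 1ℚ))) (ℚₚ.+-monoʳ-≤ 1ℚ (0≤* (ℚₚ.nonNegative⁻¹ ½) (0≤ι n))))
  (bernoulli 3/2≤x n)

-- The relation between the exponents makes x^(qr) the product of x^p, x^q and x^r, so the gap
-- becomes a polynomial in these three powers and x.
gapℚ-expand : ∀ p q r → p ℕ.+ (q ℕ.+ r) ≡ q ℕ.* r → ∀ x → gapℚ p q r x ≡
  (x ^ℚ p ℚ.- 1ℚ) ℚ.* ((x ^ℚ q ℚ.- 1ℚ) ℚ.* (x ^ℚ r ℚ.- 1ℚ)) ℚ.-
  (x ^ℚ p ℚ.* (x ^ℚ q ℚ.* x ^ℚ r) ℚ.- 1ℚ) ℚ.* ((x ℚ.- 1ℚ) ℚ.* (x ℚ.- 1ℚ))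
gapℚ-expand p q r p+q+r≡qr x = ≡.cong
  (λ y → (x ^ℚ p ℚ.- 1ℚ) ℚ.* ((x ^ℚ q ℚ.- 1ℚ) ℚ.* (x ^ℚ r ℚ.- 1ℚ)) ℚ.- (y ℚ.- 1ℚ) ℚ.* ((x ℚ.- 1ℚ) ℚ.* (x ℚ.- 1ℚ)))
  (≡.trans (≡.cong (x ^ℚ_) (≡.sym p+q+r≡qr))
    (≡.trans (^-homo-* x p (q ℕ.+ r)) (≡.cong (x ^ℚ p ℚ.*_) (^-homo-* x q r))))

-- At x = 2 the factor (x - 1)^2 is 1. With a, b, c the three powers of 2 less 1, the gap is abc -
-- ((1 + a)(1 + b)(1 + c) - 1), so the cubic terms cancel and only nonpositive terms remain.
gap[2]≤0 : ∀ {p q r} → p ℕ.+ (q ℕ.+ r) ≡ q ℕ.* r → gapℚ p q r 2ℚ ℚ.≤ 0ℚ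
gap[2]≤0 {p} {q} {r} p+q+r≡qr = ≡.subst (ℚ._≤ 0ℚ) (≡.sym (gapℚ-expand p q r p+q+r≡qr 2ℚ))
  (0≤q-p⇒p≤q (≡.subst (0ℚ ℚ.≤_)
    (solve 3 (λ A B C → let a = A :- con 1ℚ ; b = B :- con 1ℚ ; c = C :- con 1ℚ in
        a :+ (b :+ (c :+ (a :* b :+ (b :* c :+ a :* c)))) :=
        con 0ℚ :- (a :* (b :* c) :- (A :* (B :* C) :- con 1ℚ) :* ((con 2ℚ :- con 1ℚ) :* (con 2ℚ :- con 1ℚ))))
      ≡.refl (2ℚ ^ℚ p) (2ℚ ^ℚ q) (2ℚ ^ℚ r))
    (0≤+ (0≤2^ p) (0≤+ (0≤2^ q) (0≤+ (0≤2^ r)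
      (0≤+ (0≤* (0≤2^ p) (0≤2^ q)) (0≤+ (0≤* (0≤2^ q) (0≤2^ r)) (0≤* (0≤2^ p) (0≤2^ r)))))))))
  where
  0≤2^ : ∀ n → 0ℚ ℚ.≤ 2ℚ ^ℚ n ℚ.- 1ℚ
  0≤2^ n = p≤q⇒0≤q-p (1≤x^n (ℚₚ.≤ᵇ⇒≤ {1ℚ + ½} {2ℚ} _) n)

-- With A = x ^ p, B = x ^ q, C = x ^ r, the gap is a sum of products of nonnegative terms,
-- among them AB (ηC - 1), BC (ηA - 1) and AC (ηB - 1).
0≤gap[2-3η] : ∀ {p q r} → p ℕ.+ (q ℕ.+ r) ≡ q ℕ.* r → ∀ {η} → 0ℚ ℚ.≤ η →
  let x = 2ℚ ℚ.- 3ℚ ℚ.* η in 1ℚ + ½ ℚ.≤ x →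
  1ℚ ℚ.≤ η ℚ.* x ^ℚ p → 1ℚ ℚ.≤ η ℚ.* x ^ℚ q → 1ℚ ℚ.≤ η ℚ.* x ^ℚ r →
  0ℚ ℚ.≤ gapℚ p q r x
0≤gap[2-3η] {p} {q} {r} p+q+r≡qr {η} 0≤η 3/2≤x 1≤ηA 1≤ηB 1≤ηC =
  ≡.subst (0ℚ ℚ.≤_) (≡.trans identity (≡.sym (gapℚ-expand p q r p+q+r≡qr x)))
    (0≤+ (0≤* (0≤* (0≤^ p) (0≤^ q)) (p≤q⇒0≤q-p 1≤ηC))
    (0≤+ (0≤* (0≤* (0≤^ q) (0≤^ r)) (p≤q⇒0≤q-p 1≤ηA))
    (0≤+ (0≤* (0≤* (0≤^ p) (0≤^ r)) (p≤q⇒0≤q-p 1≤ηB))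
    (0≤+ (0≤^ p) (0≤+ (0≤^ q) (0≤+ (0≤^-1 r) (0≤+ 0≤x-1
    (0≤* (0≤+ (0≤* (0≤^-1 p) (0≤* (0≤^ q) (0≤^ r))) (0≤+ (0≤* (0≤^-1 q) (0≤^ r)) (0≤^-1 r)))
         (0≤* (0≤* (ℚₚ.nonNegative⁻¹ 3ℚ) 0≤η) 0≤x-1)))))))))
  where
  x : ℚ
  x = 2ℚ ℚ.- 3ℚ ℚ.* η

  0≤^-1 : ∀ n → 0ℚ ℚ.≤ x ^ℚ n ℚ.- 1ℚ
  0≤^-1 n = p≤q⇒0≤q-p (1≤x^n 3/2≤x n)

  0≤^ : ∀ n → 0ℚ ℚ.≤ x ^ℚ n
  0≤^ n = ℚₚ.≤-trans (ℚₚ.nonNegative⁻¹ 1ℚ) (1≤x^n 3/2≤x n)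

  0≤x-1 : 0ℚ ℚ.≤ x ℚ.- 1ℚ
  0≤x-1 = p≤q⇒0≤q-p (ℚₚ.≤-trans (ℚₚ.≤ᵇ⇒≤ {1ℚ} {1ℚ + ½} _) 3/2≤x)

  -- The square of y - 1 = 1 - 3η is (y - 1) - 3η (y - 1). The first part leaves 3ηABC, one share
  -- for each of -AB, -BC and -AC, whence the factor 3; the second gives (ABC - 1) times 3η (y - 1),
  -- with ABC - 1 telescoped.
  identity = solve 4 (λ A B C η → let y = con 2ℚ :- con 3ℚ :* η ; y-1 = y :- con 1ℚ in
      A :* B :* (η :* C :- con 1ℚ) :+ (B :* C :* (η :* A :- con 1ℚ) :+ (A :* C :* (η :* B :- con 1ℚ) :+
      (A :+ (B :+ ((C :- con 1ℚ) :+ (y-1 :+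
      ((A :- con 1ℚ) :* (B :* C) :+ ((B :- con 1ℚ) :* C :+ (C :- con 1ℚ))) :* (con 3ℚ :* η :* y-1))))))) :=
      (A :- con 1ℚ) :* ((B :- con 1ℚ) :* (C :- con 1ℚ)) :- (A :* (B :* C) :- con 1ℚ) :* (y-1 :* y-1))
    ≡.refl (x ^ℚ p) (x ^ℚ q) (x ^ℚ r) η

z^n-1-cancellable : ∀ x → (∀ n → 1ℚ + ½ ℚ.≤ seq x n) → ∀ n .{{_ : NonZero n}} →
                    Cancellable (ofℝ x ^ℂ n +ℂ -ℂ 1ℂ)
z^n-1-cancellable x 3/2≤x n = #⇒cancellable (ofℝ x ^ℂ n) 1ℂ (inj₁ (inj₂
  -- Bernoulli gives x^n ≥ 3/2 for n ≥ 1; the margin 1/4 instead of 1/2 makes the inequality strict.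
  (½ ℚ.* ½ , ℚₚ.positive⁻¹ (½ ℚ.* ½) , 0 , λ k _ → ℚₚ.<-≤-trans
    (ℚₚ.<-≤-trans (ℚₚ.+-monoʳ-< 1ℚ {½ ℚ.* ½} {½ ℚ.* ι 1} (ℚₚ.*-monoʳ-<-pos ½ {½} {ι 1} (ℚ.*<* (ℤ.+<+ (s≤s (s≤s z≤n))))))
      (ℚₚ.+-monoʳ-≤ 1ℚ (ℚₚ.*-monoˡ-≤-nonNeg ½ (ι-mono (ℕ.>-nonZero⁻¹ n)))))
    (≡.subst (1ℚ + ½ ℚ.* ι n ℚ.≤_) (≡.sym (proj₁ (represents-^ (ofℝ x) {seq x} (λ _ → ≡.refl , ≡.refl) n k)))
      (bernoulli (3/2≤x k) n)))))

-- Primes from Dickson's conjecture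

-- Applying `Infinite` to the list of 0 to M - 1 thus yields elements of size at least M.
∉-upTo : ∀ {M n} → ℤ.+ n ∉ map ℤ.+_ (upTo M) → M ≤ n
∉-upTo ∉ = ℕₚ.≮⇒≥ λ n<M → ∉ (∈-map⁺ ℤ.+_ (∈-upTo⁺ n<M))

unit-value⇒¬obstructed : ∀ k (a b : Vector.Vector ℤ k) t →
  ℤ.∣ ∏ℤ (λ i → a i ℤ.* t ℤ.+ b i) ∣ ≡ 1 →
  ¬ (∃[ ℓ ] Prime ℓ × (∀ (t : ℤ) → ℤ.∣ ℤ.+ ℓ ∣ ∣ ℤ.∣ ∏ℤ (λ i → a i ℤ.* t ℤ.+ b i) ∣))
unit-value⇒¬obstructed k a b t ∣∏∣≡1 (ℓ , ℓ-prime , obstructed) =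
  prime⇒≢1 ℓ-prime (∣1⇒≡1 (≡.subst (ℓ ∣_) ∣∏∣≡1 (obstructed t)))

large-prime : DicksonConjecture → ∀ M → ∃[ q ] Prime q × M ≤ q
-- The single linear form is t itself, with value 1 at t = 1.
large-prime dickson M with dickson 1 (s≤s z≤n) (λ _ → 1ℤ) (λ _ → 0ℤ) (λ _ → ℤₚ.≤-refl)
  (unit-value⇒¬obstructed 1 (λ _ → 1ℤ) (λ _ → 0ℤ) 1ℤ ≡.refl) (map ℤ.+_ (upTo M))
... | t , (0<t , values) , t∉ with values zero
...   | q , q-prime , t≡q = q , q-prime , ∉-upTo (≡.subst (_∉ map ℤ.+_ (upTo M))
        (≡.trans (≡.sym (≡.trans (ℤₚ.+-identityʳ (1ℤ ℤ.* t)) (ℤₚ.*-identityˡ t))) t≡q) t∉)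

n⊖1+n≡-1 : ∀ n → n ℤ.⊖ suc n ≡ ℤ.- 1ℤ
n⊖1+n≡-1 zero    = ≡.refl
n⊖1+n≡-1 (suc n) = ≡.trans (ℤₚ.[1+m]⊖[1+n]≡m⊖n n (suc n)) (n⊖1+n≡-1 n)

-- The linear forms are t and (q - 1) t - q, with product -1 at t = 1, so no prime obstructs.
prime-pair : DicksonConjecture → ∀ {q} → 2 ≤ q → ∀ M →
             ∃[ p ] ∃[ r ] Prime p × Prime r × p ℕ.+ (q ℕ.+ r) ≡ q ℕ.* r × M ≤ r
prime-pair dickson {suc q-1} (s≤s 1≤q-1) M
  with dickson 2 (s≤s z≤n) a b 1≤a (unit-value⇒¬obstructed 2 a b 1ℤ value-at-1) (map ℤ.+_ (upTo M))
  where
  a b : Vector.Vector ℤ 2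
  a = 1ℤ Vector.∷ ℤ.+ q-1 Vector.∷ Vector.[]
  b = 0ℤ Vector.∷ ℤ.- ℤ.+ suc q-1 Vector.∷ Vector.[]

  1≤a : ∀ i → 1ℤ ℤ.≤ a i
  1≤a zero       = ℤₚ.≤-refl
  1≤a (suc zero) = ℤ.+≤+ 1≤q-1

  value-at-1 : ℤ.∣ ∏ℤ (λ i → a i ℤ.* 1ℤ ℤ.+ b i) ∣ ≡ 1
  value-at-1 = ≡.cong (λ v → ℤ.∣ 1ℤ ℤ.* (v ℤ.* 1ℤ) ∣)
    (≡.trans (≡.cong (ℤ._+ ℤ.-[1+ q-1 ]) (ℤₚ.*-identityʳ (ℤ.+ q-1))) (n⊖1+n≡-1 q-1))
... | t , (0<t , values) , t∉ with values zero | values (suc zero)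
...   | r , r-prime , t≡r | p , p-prime , at+b≡p =
  p , r , p-prime , r-prime , p+q+r≡qr , ∉-upTo (≡.subst (_∉ map ℤ.+_ (upTo M)) t≡+r t∉)
  where
  q = suc q-1

  t≡+r : t ≡ ℤ.+ r
  t≡+r = ≡.trans (≡.sym (≡.trans (ℤₚ.+-identityʳ (1ℤ ℤ.* t)) (ℤₚ.*-identityˡ t))) t≡r

  p+q≡[q-1]r : p ℕ.+ q ≡ q-1 ℕ.* r
  p+q≡[q-1]r = ℤₚ.+-injective (begin
    ℤ.+ p ℤ.+ ℤ.+ q                                      ≡⟨ ≡.cong (ℤ._+ ℤ.+ q) at+b≡p ⟨
    ℤ.+ q-1 ℤ.* t ℤ.- ℤ.+ q ℤ.+ ℤ.+ q                    ≡⟨ ℤₚ.+-assoc (ℤ.+ q-1 ℤ.* t) (ℤ.- ℤ.+ q) (ℤ.+ q) ⟩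
    ℤ.+ q-1 ℤ.* t ℤ.+ (ℤ.- ℤ.+ q ℤ.+ ℤ.+ q)              ≡⟨ ≡.cong (λ s → ℤ.+ q-1 ℤ.* t ℤ.+ s) (ℤₚ.+-inverseˡ (ℤ.+ q)) ⟩
    ℤ.+ q-1 ℤ.* t ℤ.+ 0ℤ                                 ≡⟨ ℤₚ.+-identityʳ _ ⟩
    ℤ.+ q-1 ℤ.* t                                        ≡⟨ ≡.cong (ℤ.+ q-1 ℤ.*_) t≡+r ⟩
    ℤ.+ q-1 ℤ.* ℤ.+ r                                    ≡⟨ ℤₚ.pos-* q-1 r ⟨
    ℤ.+ (q-1 ℕ.* r)                                      ∎)
    where open ≡.≡-Reasoning

  p+q+r≡qr : p ℕ.+ (q ℕ.+ r) ≡ q ℕ.* r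
  p+q+r≡qr = ≡.trans (≡.sym (ℕₚ.+-assoc p q r)) (≡.trans (≡.cong (ℕ._+ r) p+q≡[q-1]r) (ℕₚ.+-comm (q-1 ℕ.* r) r))

-- Novelty of a triple

n-sum : List (ℕ × ℕ × ℝ) → ℕ
n-sum []                 = 0
n-sum ((_ , n , _) ∷ xs) = n ℕ.+ n-sum xs

-- A triple whose second index exceeds this sum is new to the list, and no two reals have to be
-- compared.
∈⇒n≤sum : ∀ {m n x} xs → Membership._∈_ Triples (m , n , x) xs → n ≤ n-sum xs
∈⇒n≤sum ((_ , n , _) ∷ xs) (here (_ , ≡.refl , _)) = ℕₚ.m≤m+n n (n-sum xs)
∈⇒n≤sum {x = x} ((_ , n , _) ∷ xs) (there ∈xs)             = ℕₚ.≤-trans (∈⇒n≤sum {x = x} xs ∈xs) (ℕₚ.m≤n+m (n-sum xs) n)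

-- Choice of the constants

private
  1/3 1/6 : ℚ
  1/3 = ℤ.+ 1 ℚ./ 3
  1/6 = ℤ.+ 1 ℚ./ 6

-- The bound 1/6 keeps 2 - 3η at least 3/2, where `bernoulli` applies; the bound by δ keeps 2 - 3η
-- at least 2 - δ.
small-η : ∀ {δ} → 0ℚ ℚ.< δ → Σ[ η ∈ ℚ ] 0ℚ ℚ.< η × η ℚ.≤ 1/6 × 3ℚ ℚ.* η ℚ.≤ δ
small-η {δ} 0<δ = 1/6 ℚ.⊓ (1/3 ℚ.* δ) , 0<η , ℚₚ.p⊓q≤p 1/6 (1/3 ℚ.* δ) , (begin
  3ℚ ℚ.* (1/6 ℚ.⊓ (1/3 ℚ.* δ))   ≤⟨ ℚₚ.*-monoˡ-≤-nonNeg 3ℚ (ℚₚ.p⊓q≤q 1/6 (1/3 ℚ.* δ)) ⟩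
  3ℚ ℚ.* (1/3 ℚ.* δ)           ≡⟨ ℚₚ.*-assoc 3ℚ 1/3 δ ⟨
  1ℚ ℚ.* δ                     ≡⟨ ℚₚ.*-identityˡ δ ⟩
  δ                            ∎)
  where
  open ℚₚ.≤-Reasoning
  0<η : 0ℚ ℚ.< 1/6 ℚ.⊓ (1/3 ℚ.* δ)
  0<η with ℚₚ.⊓-sel 1/6 (1/3 ℚ.* δ)
  ... | inj₁ eq = ≡.subst (0ℚ ℚ.<_) (≡.sym eq) (ℚₚ.positive⁻¹ 1/6)
  ... | inj₂ eq = ≡.subst (0ℚ ℚ.<_) (≡.sym eq)
    (ℚₚ.positive⁻¹ (1/3 ℚ.* δ) {{ℚₚ.pos*pos⇒pos 1/3 δ {{ℚ.positive 0<δ}}}})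

-- With K η > 2, Bernoulli gives η x^n ≥ η n / 2 ≥ 1 for all n ≥ K.
powers-large : ∀ {η} → 0ℚ ℚ.< η → ∃[ K ] ∀ {x} → 1ℚ + ½ ℚ.≤ x → ∀ {n} → K ≤ n → 1ℚ ℚ.≤ η ℚ.* x ^ℚ n
powers-large {η} 0<η = let K , 2<Kη = archimedean-* 2ℚ 0<η in K , λ {x} 3/2≤x {n} K≤n → begin
  1ℚ                          ≡⟨⟩
  ½ ℚ.* 2ℚ                    ≤⟨ ℚₚ.*-monoˡ-≤-nonNeg ½ (ℚₚ.<⇒≤ 2<Kη) ⟩
  ½ ℚ.* (ι K ℚ.* η)           ≡⟨ solve 2 (λ k η → con ½ :* (k :* η) := η :* (con 0ℚ :+ con ½ :* k)) ≡.refl (ι K) η ⟩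
  η ℚ.* (0ℚ + ½ ℚ.* ι K)      ≤⟨ ℚₚ.*-monoˡ-≤-nonNeg η {{ℚ.nonNegative (ℚₚ.<⇒≤ 0<η)}}
    (ℚₚ.≤-trans (ℚₚ.+-mono-≤ (ℚₚ.nonNegative⁻¹ 1ℚ) (ℚₚ.*-monoˡ-≤-nonNeg ½ (ι-mono K≤n))) (bernoulli 3/2≤x n)) ⟩
  η ℚ.* x ^ℚ n                ∎
  where open ℚₚ.≤-Reasoning

-- Since qr ≥ 3r ≥ q + q + r, the remaining summand p is at least q; making q large therefore makes
-- all three primes large.
q≤p : ∀ {p q r} → p ℕ.+ (q ℕ.+ r) ≡ q ℕ.* r → 3 ≤ q → q ≤ r → q ≤ p
q≤p {p} {q} {r} p+q+r≡qr 3≤q q≤r = ℕₚ.+-cancelʳ-≤ (q ℕ.+ r) q p (begin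
  q ℕ.+ (q ℕ.+ r)     ≤⟨ ℕₚ.+-mono-≤ q≤r (ℕₚ.+-mono-≤ q≤r (ℕₚ.≤-reflexive (≡.sym (ℕₚ.+-identityʳ r)))) ⟩
  3 ℕ.* r             ≤⟨ ℕₚ.*-monoˡ-≤ r 3≤q ⟩
  q ℕ.* r             ≡⟨ p+q+r≡qr ⟨
  p ℕ.+ (q ℕ.+ r)     ∎)
  where open ℕₚ.≤-Reasoning

-- The two sides agree by unfolding definitions, but refl would compare Cauchy moduli at
-- great cost; comparing the components in ℚ avoids that.
Φ≈Ψ : ∀ n ζ z → Φ n ζ z ≈ℂ Ψ n ζ z
Φ≈Ψ n ζ z = Ψ-cong n ζ z (λ a → z +ℂ -ℂ (ζ ^ℂ a)) λ a →
  pointwiseℂ (z +ℂ -ℂ (ζ ^ℂ a)) (linear ζ z a) (λ _ → ≡.refl) (λ _ → ≡.refl)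

Ψ-agree⇒Φ-agree : ∀ {m n} ζ ξ z → Ψ m ζ z ≈ℂ Ψ n ξ z → Φ m ζ z ≈ℂ Φ n ξ z
Ψ-agree⇒Φ-agree {m} {n} ζ ξ z Ψ≈Ψ =
  ℂᵣ.trans {Φ m ζ z} {Ψ m ζ z} {Φ n ξ z} (Φ≈Ψ m ζ z)
    (ℂᵣ.trans {Ψ m ζ z} {Ψ n ξ z} {Φ n ξ z} Ψ≈Ψ (ℂᵣ.sym {Φ n ξ z} {Ψ n ξ z} (Φ≈Ψ n ξ z)))

-- A common value near 2

gap-root⇒agree : ∀ {p q r} → Prime p → Prime q → Prime r → q ≢ r →
  ∀ x → (∀ n → 1ℚ + ½ ℚ.≤ seq x n) → gapℂ p q r (ofℝ x) ≈ℂ ofℝ 0ℝ → CyclotomicValuesAgree p (q ℕ.* r) x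
gap-root⇒agree {p} {q} {r} p-prime q-prime r-prime q≢r x 3/2≤x gap≈0 ζ ξ ζ-order ξ-order =
  Ψ-agree⇒Φ-agree {p} {q ℕ.* r} ζ ξ (ofℝ x)
    (Ψ-agree {p} {q} {r} p-prime q-prime r-prime q≢r ζ ξ (primitive⇒ {p} {ζ} ζ-order) (primitive⇒ {q ℕ.* r} {ξ} ξ-order)
      (ofℝ x) (z^n-1-cancellable x 3/2≤x) gap≈0)

-- The root is bracketed by 2 - 3η and 2. The threshold K precedes the primes, so q can be fixed
-- before Dickson's conjecture supplies p and r.
agree-near-2 : ∀ {η} → 0ℚ ℚ.< η → η ℚ.≤ 1/6 → ∃[ K ] ∀ {p q r} → Prime p → Prime q → Prime r →
  p ℕ.+ (q ℕ.+ r) ≡ q ℕ.* r → K ≤ p → K ≤ q → q ℕ.< r →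
  Σ[ x ∈ ℝ ] (∀ n → 1ℚ + ½ ℚ.≤ seq x n) × (∀ n → 2ℚ ℚ.- 3ℚ ℚ.* η ℚ.≤ seq x n) × CyclotomicValuesAgree p (q ℕ.* r) x
agree-near-2 {η} 0<η η≤1/6 = K , λ {p} {q} {r} p-prime q-prime r-prime p+q+r≡qr K≤p K≤q q<r →
  agree p-prime q-prime r-prime (ℕₚ.<⇒≢ q<r)
    (gap-root p q r 2-3η 2ℚ 2-3η≤2
      (0≤gap[2-3η] {p} {q} {r} p+q+r≡qr (ℚₚ.<⇒≤ 0<η) 3/2≤2-3η
        (large K≤p) (large K≤q) (large (ℕₚ.≤-trans K≤q (ℕₚ.<⇒≤ q<r))))
      (gap[2]≤0 {p} {q} {r} p+q+r≡qr))
  where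
  K : ℕ
  K = proj₁ (powers-large 0<η)

  2-3η : ℚ
  2-3η = 2ℚ ℚ.- 3ℚ ℚ.* η

  3/2≤2-3η : 1ℚ + ½ ℚ.≤ 2-3η
  3/2≤2-3η = ℚₚ.+-monoʳ-≤ 2ℚ (ℚₚ.neg-antimono-≤ (ℚₚ.*-monoˡ-≤-nonNeg 3ℚ η≤1/6))

  large : ∀ {n} → K ≤ n → 1ℚ ℚ.≤ η ℚ.* 2-3η ^ℚ n
  large = proj₂ (powers-large 0<η) 3/2≤2-3η

  2-3η≤2 : 2-3η ℚ.≤ 2ℚ
  2-3η≤2 = 0≤q-p⇒p≤q (≡.subst (0ℚ ℚ.≤_)
    (solve 1 (λ y → y := con 2ℚ :- (con 2ℚ :- y)) ≡.refl (3ℚ ℚ.* η))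
    (0≤* (ℚₚ.nonNegative⁻¹ 3ℚ) (ℚₚ.<⇒≤ 0<η)))

  agree : ∀ {p q r} → Prime p → Prime q → Prime r → q ≢ r →
    Σ[ x ∈ ℝ ] (∀ n → 2-3η ℚ.≤ seq x n) × gapℂ p q r (ofℝ x) ≈ℂ ofℝ 0ℝ →
    Σ[ x ∈ ℝ ] (∀ n → 1ℚ + ½ ℚ.≤ seq x n) × (∀ n → 2-3η ℚ.≤ seq x n) × CyclotomicValuesAgree p (q ℕ.* r) x
  agree p-prime q-prime r-prime q≢r (x , 2-3η≤x , gap≈0) =
    x , 3/2≤x , 2-3η≤x , gap-root⇒agree p-prime q-prime r-prime q≢r x 3/2≤x gap≈0
    where
    3/2≤x : ∀ n → 1ℚ + ½ ℚ.≤ seq x n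
    3/2≤x n = ℚₚ.≤-trans 3/2≤2-3η (2-3η≤x n)

-- Past both thresholds the terms would satisfy 2 - 3η ≤ |x| < 2 - ε < 2 - δ ≤ 2 - 3η.
¬<2-ε : ∀ ε δ N → (∀ n → N ≤ n → 0ℚ + δ ℚ.< seq ε n) → ∀ {η} → 3ℚ ℚ.* η ℚ.≤ δ →
        ∀ x → (∀ n → 2ℚ ℚ.- 3ℚ ℚ.* η ℚ.≤ seq x n) → ¬ (∣ x ∣ℝ <ℝ fromℚ (1ℚ + 1ℚ) -ℝ ε)
¬<2-ε ε δ N δ<ε {η} 3η≤δ x 2-3η≤x (γ , 0<γ , N′ , x+γ<2-ε) = ℚₚ.<-irrefl ≡.refl (begin-strict
  2ℚ ℚ.- 3ℚ ℚ.* η         ≤⟨ 2-3η≤x n ⟩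
  seq x n                 ≤⟨ p≤∣p∣ (seq x n) ⟩
  ℚ.∣ seq x n ∣           ≡⟨ ℚₚ.+-identityʳ _ ⟨
  ℚ.∣ seq x n ∣ + 0ℚ      <⟨ ℚₚ.+-monoʳ-< ℚ.∣ seq x n ∣ 0<γ ⟩
  ℚ.∣ seq x n ∣ + γ       <⟨ x+γ<2-ε n (ℕₚ.m≤n⊔m N N′) ⟩
  2ℚ ℚ.- seq ε n          <⟨ ℚₚ.+-monoʳ-< 2ℚ (ℚₚ.neg-antimono-< (δ<ε n (ℕₚ.m≤m⊔n N N′))) ⟩
  2ℚ ℚ.- (0ℚ + δ)         ≡⟨ ≡.cong (λ y → 2ℚ ℚ.- y) (ℚₚ.+-identityˡ δ) ⟩
  2ℚ ℚ.- δ                ≤⟨ ℚₚ.+-monoʳ-≤ 2ℚ (ℚₚ.neg-antimono-≤ 3η≤δ) ⟩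
  2ℚ ℚ.- 3ℚ ℚ.* η         ∎)
  where
  open ℚₚ.≤-Reasoning
  n : ℕ
  n = N ℕ.⊔ N′

mainTheorem3 : DicksonConjecture →
    ∀ (ε : ℝ) → 0ℝ <ℝ ε →
    Infinite Triples (λ (m , n , x) →
    1 ≤ m × 1 ≤ n × m ≢ n × x #ℝ 0ℝ ×
    CyclotomicValuesAgree m n x ×
    ¬ (fromℚ ½ <ℝ ∣ x ∣ℝ × ∣ x ∣ℝ <ℝ fromℚ (1ℚ + 1ℚ) -ℝ ε))
-- The rational δ is the margin contained in the proof of 0 < ε.
mainTheorem3 dickson ε (δ , 0<δ , N , δ<ε) xs = with-η (small-η 0<δ)
  where
  Goal : ℕ × ℕ × ℝ → Set
  Goal (m , n , x) =
    1 ≤ m × 1 ≤ n × m ≢ n × x #ℝ 0ℝ × CyclotomicValuesAgree m n x ×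
    ¬ (fromℚ ½ <ℝ ∣ x ∣ℝ × ∣ x ∣ℝ <ℝ fromℚ (1ℚ + 1ℚ) -ℝ ε)

  Result : Set
  Result = ∃[ t ] Goal t × Membership._∉_ Triples t xs

  with-x : ∀ {p q r η} → Prime p → p ℕ.+ (q ℕ.+ r) ≡ q ℕ.* r → 3 ≤ q → suc q ℕ.+ n-sum xs ≤ r → 3ℚ ℚ.* η ℚ.≤ δ →
    Σ[ x ∈ ℝ ] (∀ n → 1ℚ + ½ ℚ.≤ seq x n) × (∀ n → 2ℚ ℚ.- 3ℚ ℚ.* η ℚ.≤ seq x n) × CyclotomicValuesAgree p (q ℕ.* r) x →
    Result
  with-x {p} {q} {r} {η} p-prime p+q+r≡qr 3≤q M≤r 3η≤δ (x , 3/2≤x , 2-3η≤x , agree) =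
    (p , q ℕ.* r , x) ,
    ( ℕ.>-nonZero⁻¹ p {{prime⇒nonZero p-prime}}
    , ℕₚ.*-mono-≤ 1≤q (ℕₚ.≤-trans (s≤s z≤n) M≤r)
    -- As q + r is positive, p is smaller than p + (q + r) = qr.
    , ℕₚ.<⇒≢ (≡.subst (p ℕ.<_) p+q+r≡qr (ℕₚ.m<m+n p (ℕₚ.≤-trans 1≤q (ℕₚ.m≤m+n q r))))
    , inj₂ (1ℚ , ℚₚ.positive⁻¹ 1ℚ , 0 , λ n _ → ℚₚ.<-≤-trans (ℚ.*<* (ℤ.+<+ (s≤s (s≤s (s≤s z≤n))))) (3/2≤x n))
    , agree
    -- It is the upper bound on |x| that fails.
    , λ (_ , x<2-ε) → ¬<2-ε ε δ N δ<ε {η} 3η≤δ x 2-3η≤x x<2-ε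
    ) ,
    λ ∈xs → ℕₚ.<⇒≱ sum<qr (∈⇒n≤sum {x = x} xs ∈xs)
    where
    1≤q : 1 ≤ q
    1≤q = ℕₚ.≤-trans (s≤s z≤n) 3≤q

    sum<qr : n-sum xs ℕ.< q ℕ.* r
    sum<qr = ℕₚ.<-≤-trans (ℕₚ.≤-trans (s≤s (ℕₚ.m≤n+m (n-sum xs) q)) M≤r) (ℕₚ.m≤n*m r q {{ℕ.>-nonZero 1≤q}})

  with-η : (Σ[ η ∈ ℚ ] 0ℚ ℚ.< η × η ℚ.≤ 1/6 × 3ℚ ℚ.* η ℚ.≤ δ) → Result
  -- Adding 3 to K secures both q ≥ 3, for `q≤p`, and q ≥ K, for the sign of the gap at 2 - 3η.
  with-η (η , 0<η , η≤1/6 , 3η≤δ) = with-q (large-prime dickson (3 ℕ.+ K))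
    where
    K : ℕ
    K = proj₁ (agree-near-2 0<η η≤1/6)

    with-q : (∃[ q ] Prime q × 3 ℕ.+ K ≤ q) → Result
    with-q (q , q-prime , 3+K≤q) =
      -- This lower bound on r gives q < r and at the same time makes qr exceed every second index
      -- in `xs`.
      with-pr (prime-pair dickson (ℕₚ.≤-trans (ℕₚ.n≤1+n 2) 3≤q) (suc q ℕ.+ n-sum xs))
      where
      3≤q : 3 ≤ q
      3≤q = ℕₚ.m+n≤o⇒m≤o 3 3+K≤q

      K≤q : K ≤ q
      K≤q = ℕₚ.m+n≤o⇒n≤o 3 3+K≤q

      with-pr : (∃[ p ] ∃[ r ] Prime p × Prime r × p ℕ.+ (q ℕ.+ r) ≡ q ℕ.* r × suc q ℕ.+ n-sum xs ≤ r) → Result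
      with-pr (p , r , p-prime , r-prime , p+q+r≡qr , M≤r) =
        with-x {η = η} p-prime p+q+r≡qr 3≤q M≤r 3η≤δ
          (proj₂ (agree-near-2 0<η η≤1/6) p-prime q-prime r-prime p+q+r≡qr
            (ℕₚ.≤-trans K≤q (q≤p p+q+r≡qr 3≤q (ℕₚ.<⇒≤ q<r))) K≤q q<r)
        where
        q<r : q ℕ.< r
        q<r = ℕₚ.m+n≤o⇒m≤o (suc q) M≤r
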